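{- Let $A$ be a prenex $\mathrm{RPL}\forall$-formula. Then the following are equivalent: (1) $A$ is provable in $\mathrm{G}^1\text{\L}\forall$; (2) $A$ is provable in $\mathrm{G}^2\text{\L}\forall$; (3) $A$ is provable in $\mathrm{G}^3\text{\L}\forall$.
   Context: Syntax. Fix a signature of predicate and function symbols of arbitrary nonnegative arities that includes a countable set of nullary function symbols called parameters (there are infinitely many of them). Terms are standard. Atomic $\mathrm{RPL}\forall$-formulas are $P(t_1,\dots,t_n)$ ($P$ a predicate symbol, $t_i$ terms) and truth constants $\bar r$ for rational $r\in[0,1]$. $\mathrm{RPL}\forall$-formulas are built from these using the logical symbols $\to$ (binary), $\forall$, $\exists$. A prenex formula consists of a (possibly empty) string of quantifiers followed by a quantifier-free formula. $[A]^x_t$ is the result of substituting $t$ for all free occurrences of the variable $x$ in $A$. In addition there are countably (infinitely) many semipropositional variables of type 1, and countably (infinitely) many semipropositional variables of type 0. A formula is an $\mathrm{RPL}\forall$-formula or a semipropositional variable (so semipropositional variables do not occur inside compound formulas). An atom is an atomic $\mathrm{RPL}\forall$-formula or a semipropositional variable. A sequent $\Gamma\Rightarrow\Delta$ is an ordered pair of finite multisets of formulas (its members); it is atomic if all its members are atoms. A hypersequent $S_1\,|\,\cdots\,|\,S_n$ is a finite multiset of sequents. Semantics (needed for axioms). An hs-interpretation $M=\langle\mathcal{D},\mu\rangle$ has a nonempty domain $\mathcal{D}$; $\mu$ interprets $n$-ary function symbols by functions $\mathcal{D}^n\to\mathcal{D}$, $n$-ary predicate symbols by maps $\mathcal{D}^n\to[0,1]$,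 each semipropositional variable of type 0 by a real in $[0,+\infty)$, and each of type 1 by a real in $(-\infty,1]$. A valuation $\nu$ maps individual variables to $\mathcal{D}$. For atoms: $|\bar r|_{M,\nu}=r$; $|P(t_1,\dots,t_n)|_{M,\nu}=\mu(P)(|t_1|_{M,\nu},\dots,|t_n|_{M,\nu})$; a semipropositional variable has the value given by $\mu$. For a finite multiset $\Gamma$ of atoms, $|\Gamma|_{M,\nu}=\sum_{F\in\Gamma}(|F|_{M,\nu}-1)$ (with multiplicity; $0$ if $\Gamma$ is empty). An atomic sequent $\Gamma\Rightarrow\Delta$ is true under $M,\nu$ if $|\Delta|_{M,\nu}-|\Gamma|_{M,\nu}\geqslant0$. Calculus $\mathrm{G}^3\text{\L}\forall$. Axioms: all hypersequents in which, for every hs-interpretation $M$ and valuation $\nu$, there is an atomic sequent true under $M$ and $\nu$. Rules (premises / conclusion), with $A,B$ $\mathrm{RPL}\forall$-formulas, $\Gamma,\Delta$ finite multisets of formulas, $\mathcal{G}$ a (possibly empty) hypersequent: $(\to\Rightarrow)^3$: $\mathcal{G}\,|\,\Gamma,\mathfrak{p}\Rightarrow\Delta\,|\,B\Rightarrow\mathfrak{p},A$ / $\mathcal{G}\,|\,\Gamma,A\to B\Rightarrow\Delta$; $(\Rightarrow\to)^3$: $\mathcal{G}\,|\,\Gamma\Rightarrow\Delta$ and $\mathcal{G}\,|\,\Gamma,A\Rightarrow B,\Delta$ / $\mathcal{G}\,|\,\Gamma\Rightarrow A\to B,\Delta$; $(\forall\Rightarrow)^3$: $\mathcal{G}\,|\,\Gamma,\mathfrak{p}\Rightarrow\Delta\,|\,\forall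 xA\Rightarrow\mathfrak{p}\,|\,[A]^x_t\Rightarrow\mathfrak{p}$ / $\mathcal{G}\,|\,\Gamma,\forall xA\Rightarrow\Delta$; $(\Rightarrow\forall)^3$: $\mathcal{G}\,|\,\Gamma\Rightarrow[A]^x_a,\Delta$ / $\mathcal{G}\,|\,\Gamma\Rightarrow\forall xA,\Delta$; $(\Rightarrow\exists)^3$: $\mathcal{G}\,|\,\Gamma\Rightarrow\mathfrak{q},\Delta\,|\,\mathfrak{q}\Rightarrow\exists xA\,|\,\mathfrak{q}\Rightarrow[A]^x_t$ / $\mathcal{G}\,|\,\Gamma\Rightarrow\exists xA,\Delta$; $(\exists\Rightarrow)^3$: $\mathcal{G}\,|\,\Gamma,[A]^x_a\Rightarrow\Delta$ / $\mathcal{G}\,|\,\Gamma,\exists xA\Rightarrow\Delta$. Here $\mathfrak{p}$ (type 1) and $\mathfrak{q}$ (type 0) are semipropositional variables not occurring in the conclusion, $t$ is a closed term, and $a$ is a parameter not occurring in the conclusion. Calculi $\mathrm{G}^1\text{\L}\forall$ and $\mathrm{G}^2\text{\L}\forall$. Both work with hypersequents containing no semipropositional variables of type 0; their axioms are such hypersequents satisfying the same axiom condition. In their rules, $\mathfrak{p}$ is a semipropositional variable of type 1 not occurring in the conclusion, $t$ is a closed term, and $a$ is a parameter not occurring in the conclusion. Rules of $\mathrm{G}^1\text{\L}\forall$: $(\to\Rightarrow)^1$: $\mathcal{G}\,|\,\Gamma,A\to B\Rightarrow\Delta\,|\,\Gamma,\mathfrak{p}\Rightarrow\Delta\,|\,B\Rightarrow\mathfrak{p},A$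 / $\mathcal{G}\,|\,\Gamma,A\to B\Rightarrow\Delta$; $(\Rightarrow\to)^1$: $\mathcal{G}\,|\,\Gamma\Rightarrow A\to B,\Delta\,|\,\Gamma\Rightarrow\Delta$ and $\mathcal{G}\,|\,\Gamma\Rightarrow A\to B,\Delta\,|\,\Gamma,A\Rightarrow B,\Delta$ / $\mathcal{G}\,|\,\Gamma\Rightarrow A\to B,\Delta$; $(\forall\Rightarrow)^1$: $\mathcal{G}\,|\,\Gamma,\forall xA\Rightarrow\Delta\,|\,\Gamma,[A]^x_t\Rightarrow\Delta$ / $\mathcal{G}\,|\,\Gamma,\forall xA\Rightarrow\Delta$; $(\Rightarrow\forall)^1$: $\mathcal{G}\,|\,\Gamma\Rightarrow\forall xA,\Delta\,|\,\Gamma\Rightarrow[A]^x_a,\Delta$ / $\mathcal{G}\,|\,\Gamma\Rightarrow\forall xA,\Delta$; $(\Rightarrow\exists)^1$: $\mathcal{G}\,|\,\Gamma\Rightarrow\exists xA,\Delta\,|\,\Gamma\Rightarrow[A]^x_t,\Delta$ / $\mathcal{G}\,|\,\Gamma\Rightarrow\exists xA,\Delta$; $(\exists\Rightarrow)^1$: $\mathcal{G}\,|\,\Gamma,\exists xA\Rightarrow\Delta\,|\,\Gamma,[A]^x_a\Rightarrow\Delta$ / $\mathcal{G}\,|\,\Gamma,\exists xA\Rightarrow\Delta$. Rules of $\mathrm{G}^2\text{\L}\forall$: $(\to\Rightarrow)^2$, $(\Rightarrow\to)^2$, $(\Rightarrow\forall)^2$, $(\exists\Rightarrow)^2$ have the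 same form as $(\to\Rightarrow)^3$, $(\Rightarrow\to)^3$, $(\Rightarrow\forall)^3$, $(\exists\Rightarrow)^3$, while $(\forall\Rightarrow)^2$ and $(\Rightarrow\exists)^2$ have the same form as $(\forall\Rightarrow)^1$ and $(\Rightarrow\exists)^1$. Proofs in each calculus are finite trees of hypersequents built by the rules with all leaves axioms. A proof of an $\mathrm{RPL}\forall$-formula $A$ is a proof of the hypersequent consisting of the single sequent $\Rightarrow A$. -}

module Defs where

open import Data.Nat.Base using (ℕ; zero; suc)
open import Data.Nat.Properties using () renaming (_≟_ to _≟ℕ_)
open import Data.Rational.Base using (ℚ; 0ℚ; 1ℚ; ½; ∣_∣)
  renaming (_+_ to _+ℚ_; _-_ to _-ℚ_; -_ to -ℚ_; _*_ to _*ℚ_; _≤_ to _≤ℚ_)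
import Data.Rational.Properties as ℚₚ
open import Data.Rational.Solver using (module +-*-Solver)
open import Data.List.Base using (List; []; _∷_; [_])
open import Data.List.Relation.Unary.All using (All; []; _∷_)
open import Data.List.Relation.Unary.Any using (Any)
open import Data.List.Relation.Binary.Permutation.Propositional using (_↭_)
open import Data.List.Relation.Binary.Permutation.Homogeneous using (Permutation)
open import Data.Product.Base using (Σ-syntax; _×_)
open import Data.Sum.Base using (_⊎_)
open import Data.Vec.Base using (Vec; []; _∷_)
import Data.Vec.Relation.Unary.All as Vec
import Data.Vec.Relation.Unary.Any as Vec
open import Relation.Binary.PropositionalEquality
  using (_≡_; refl; sym; trans; cong; cong₂; subst)
open import Relation.Nullary using (¬_)
open import Relation.Nullary.Decidable using (yes; no)

------------------------------------------------------------------------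
-- Real numbers, as Cauchy sequences of rationals with the n-th term
-- within 2⁻ⁿ of the limit.  Equality of reals is x ≤ y and y ≤ x, not _≡_.

2^- : ℕ → ℚ
2^- zero    = 1ℚ
2^- (suc n) = ½ *ℚ 2^- n

record ℝ : Set where
  field
    seq     : ℕ → ℚ
    regular : ∀ m n → ∣ seq m -ℚ seq n ∣ ≤ℚ 2^- m +ℚ 2^- n

open ℝ public

private
  0≤2^- : ∀ n → 0ℚ ≤ℚ 2^- n
  0≤2^- zero    = ℚₚ.nonNegative⁻¹ 1ℚ
  0≤2^- (suc n) = subst (_≤ℚ 2^- (suc n)) (ℚₚ.*-zeroʳ ½)
                    (ℚₚ.*-monoˡ-≤-nonNeg ½ (0≤2^- n))

  rearrange : ∀ a b c d → (a +ℚ b) -ℚ (c +ℚ d) ≡ (a -ℚ c) +ℚ (b -ℚ d)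
  rearrange = solve 4 (λ a b c d →
      (a :+ b) :- (c :+ d) := (a :- c) :+ (b :- d)) refl
    where open +-*-Solver

  neg-diff : ∀ a b → (-ℚ a) -ℚ (-ℚ b) ≡ -ℚ (a -ℚ b)
  neg-diff = solve 2 (λ a b → (:- a) :- (:- b) := :- (a :- b)) refl
    where open +-*-Solver

  halves : ∀ a b → ((½ *ℚ a) +ℚ (½ *ℚ b)) +ℚ ((½ *ℚ a) +ℚ (½ *ℚ b)) ≡ a +ℚ b
  halves = solve 2 (λ a b →
      ((con ½ :* a) :+ (con ½ :* b)) :+ ((con ½ :* a) :+ (con ½ :* b)) := a :+ b) refl
    where open +-*-Solver

fromℚ : ℚ → ℝ
fromℚ q .seq     _   = q
fromℚ q .regular m n = subst (_≤ℚ 2^- m +ℚ 2^- n)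
  (sym (cong ∣_∣ (ℚₚ.+-inverseʳ q)))
  (ℚₚ.+-mono-≤ (0≤2^- m) (0≤2^- n))

infixl 6 _+_ _-_
infix  4 _≤_

_+_ : ℝ → ℝ → ℝ
(x + y) .seq     n   = seq x (suc n) +ℚ seq y (suc n)
(x + y) .regular m n = begin
  ∣ (x′ m +ℚ y′ m) -ℚ (x′ n +ℚ y′ n) ∣
    ≡⟨ cong ∣_∣ (rearrange (x′ m) (y′ m) (x′ n) (y′ n)) ⟩
  ∣ (x′ m -ℚ x′ n) +ℚ (y′ m -ℚ y′ n) ∣
    ≤⟨ ℚₚ.∣p+q∣≤∣p∣+∣q∣ (x′ m -ℚ x′ n) (y′ m -ℚ y′ n) ⟩
  ∣ x′ m -ℚ x′ n ∣ +ℚ ∣ y′ m -ℚ y′ n ∣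
    ≤⟨ ℚₚ.+-mono-≤ (regular x (suc m) (suc n)) (regular y (suc m) (suc n)) ⟩
  (2^- (suc m) +ℚ 2^- (suc n)) +ℚ (2^- (suc m) +ℚ 2^- (suc n))
    ≡⟨ halves (2^- m) (2^- n) ⟩
  2^- m +ℚ 2^- n ∎
  where
  open ℚₚ.≤-Reasoning
  x′ y′ : ℕ → ℚ
  x′ k = seq x (suc k)
  y′ k = seq y (suc k)

-_ : ℝ → ℝ
(- x) .seq     n   = -ℚ seq x n
(- x) .regular m n = subst (_≤ℚ 2^- m +ℚ 2^- n)
  (sym (trans (cong ∣_∣ (neg-diff (seq x m) (seq x n)))
              (ℚₚ.∣-p∣≡∣p∣ (seq x m -ℚ seq x n))))
  (regular x m n)

_-_ : ℝ → ℝ → ℝ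
x - y = x + (- y)

_≤_ : ℝ → ℝ → Set
x ≤ y = ∀ n → seq x n ≤ℚ seq y n +ℚ (2^- n +ℚ 2^- n)

0ℝ 1ℝ : ℝ
0ℝ = fromℚ 0ℚ
1ℝ = fromℚ 1ℚ

------------------------------------------------------------------------
-- Syntax

-- Fun n holds the n-ary function symbols that are not parameters; the
-- parameters are the further nullary function symbols `param a` of Term.
record Signature : Set₁ where
  field
    Fun  : ℕ → Set
    Pred : ℕ → Set

module Calculi (Sg : Signature) where
  open Signature Sg

  data Term : Set where
    var   : ℕ → Term
    param : ℕ → Term
    fun   : ∀ {n} → Fun n → Vec Term n → Term

  infixr 7 _⟶_

  data RPL : Set where
    pred  : ∀ {n} → Pred n → Vec Term n → RPL
    const : (r : ℚ) → .(0ℚ ≤ℚ r) → .(r ≤ℚ 1ℚ) → RPL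
    _⟶_   : RPL → RPL → RPL
    all   : ℕ → RPL → RPL
    ex    : ℕ → RPL → RPL

  data QuantifierFree : RPL → Set where
    pred  : ∀ {n} {P : Pred n} {ts} → QuantifierFree (pred P ts)
    const : ∀ {r} .{0≤r : 0ℚ ≤ℚ r} .{r≤1 : r ≤ℚ 1ℚ} →
            QuantifierFree (const r 0≤r r≤1)
    _⟶_   : ∀ {A B} → QuantifierFree A → QuantifierFree B → QuantifierFree (A ⟶ B)

  data Prenex : RPL → Set where
    qf  : ∀ {A} → QuantifierFree A → Prenex A
    all : ∀ {x A} → Prenex A → Prenex (all x A)
    ex  : ∀ {x A} → Prenex A → Prenex (ex x A)

  data Closed : Term → Set where
    param : ∀ {a} → Closed (param a)
    fun   : ∀ {n} {f : Fun n} {ts} → Vec.All Closed ts → Closed (fun f ts)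

  mutual
    substTerm : ℕ → Term → Term → Term
    substTerm x t (var y) with x ≟ℕ y
    ... | yes _ = t
    ... | no  _ = var y
    substTerm x t (param a)  = param a
    substTerm x t (fun f ts) = fun f (substTerms x t ts)

    substTerms : ∀ {n} → ℕ → Term → Vec Term n → Vec Term n
    substTerms x t []       = []
    substTerms x t (s ∷ ss) = substTerm x t s ∷ substTerms x t ss

  -- A [ x ≔ t ] does not rename bound variables: the calculi substitute only
  -- closed terms, for which no capture can occur.
  infix 8 _[_≔_]

  _[_≔_] : RPL → ℕ → Term → RPL
  pred P ts       [ x ≔ t ] = pred P (substTerms x t ts)
  const r 0≤r r≤1 [ x ≔ t ] = const r 0≤r r≤1
  (A ⟶ B)         [ x ≔ t ] = A [ x ≔ t ] ⟶ B [ x ≔ t ]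
  all y A         [ x ≔ t ] with x ≟ℕ y
  ... | yes _ = all y A
  ... | no  _ = all y (A [ x ≔ t ])
  ex y A          [ x ≔ t ] with x ≟ℕ y
  ... | yes _ = ex y A
  ... | no  _ = ex y (A [ x ≔ t ])

  -- 𝔭 i and 𝔮 i are the semipropositional variables of type 1 and of type 0.
  data Formula : Set where
    rpl : RPL → Formula
    𝔭   : ℕ → Formula
    𝔮   : ℕ → Formula

  data Atom : Formula → Set where
    pred  : ∀ {n} {P : Pred n} {ts} → Atom (rpl (pred P ts))
    const : ∀ {r} .{0≤r : 0ℚ ≤ℚ r} .{r≤1 : r ≤ℚ 1ℚ} →
            Atom (rpl (const r 0≤r r≤1))
    𝔭     : ∀ {i} → Atom (𝔭 i)
    𝔮     : ∀ {i} → Atom (𝔮 i)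

  -- Finite multisets are represented by lists; _≋_ below identifies the lists
  -- that represent the same hypersequent.
  infix 4 _⇒_

  record Sequent : Set where
    constructor _⇒_
    field
      antecedent succedent : List Formula

  open Sequent public

  Hypersequent : Set
  Hypersequent = List Sequent

  infix 4 _≋_

  _≋_ : Hypersequent → Hypersequent → Set
  _≋_ = Permutation λ S T →
    (antecedent S ↭ antecedent T) × (succedent S ↭ succedent T)

  SomeMember : (Formula → Set) → Hypersequent → Set
  SomeMember P = Any λ S → Any P (antecedent S) ⊎ Any P (succedent S)

  data ParamInTerm (a : ℕ) : Term → Set where
    param : ParamInTerm a (param a)
    fun   : ∀ {n} {f : Fun n} {ts} →
            Vec.Any (ParamInTerm a) ts → ParamInTerm a (fun f ts)

  data ParamIn (a : ℕ) : RPL → Set where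
    pred : ∀ {n} {P : Pred n} {ts} → Vec.Any (ParamInTerm a) ts → ParamIn a (pred P ts)
    ⟶ˡ   : ∀ {A B} → ParamIn a A → ParamIn a (A ⟶ B)
    ⟶ʳ   : ∀ {A B} → ParamIn a B → ParamIn a (A ⟶ B)
    all  : ∀ {x A} → ParamIn a A → ParamIn a (all x A)
    ex   : ∀ {x A} → ParamIn a A → ParamIn a (ex x A)

  data ParamInFormula (a : ℕ) : Formula → Set where
    rpl : ∀ {A} → ParamIn a A → ParamInFormula a (rpl A)

  infix 4 _#ₐ_ _#_

  _#ₐ_ : ℕ → Hypersequent → Set
  a #ₐ H = ¬ SomeMember (ParamInFormula a) H

  -- Used for semipropositional variables F only, which occur in no formula
  -- other than themselves.
  _#_ : Formula → Hypersequent → Set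
  F # H = ¬ SomeMember (F ≡_) H

  ----------------------------------------------------------------------
  -- Semantics

  record HSInterpretation : Set₁ where
    field
      Dom      : Set
      nonempty : Dom
      funᴵ     : ∀ {n} → Fun n → Vec Dom n → Dom
      paramᴵ   : ℕ → Dom
      predᴵ    : ∀ {n} → Pred n → Vec Dom n → ℝ
      predᴵ≥0  : ∀ {n} (P : Pred n) ds → 0ℝ ≤ predᴵ P ds
      predᴵ≤1  : ∀ {n} (P : Pred n) ds → predᴵ P ds ≤ 1ℝ
      𝔮ᴵ       : ℕ → ℝ
      𝔮ᴵ≥0     : ∀ i → 0ℝ ≤ 𝔮ᴵ i
      𝔭ᴵ       : ℕ → ℝ
      𝔭ᴵ≤1     : ∀ i → 𝔭ᴵ i ≤ 1ℝ

  module _ (M : HSInterpretation) (ν : ℕ → HSInterpretation.Dom M) where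
    open HSInterpretation M

    mutual
      ⟦_⟧ᵗ : Term → Dom
      ⟦ var x ⟧ᵗ    = ν x
      ⟦ param a ⟧ᵗ  = paramᴵ a
      ⟦ fun f ts ⟧ᵗ = funᴵ f ⟦ ts ⟧ᵗˢ

      ⟦_⟧ᵗˢ : ∀ {n} → Vec Term n → Vec Dom n
      ⟦ [] ⟧ᵗˢ     = []
      ⟦ t ∷ ts ⟧ᵗˢ = ⟦ t ⟧ᵗ ∷ ⟦ ts ⟧ᵗˢ

    ⟦_⟧ : ∀ {F} → Atom F → ℝ
    ⟦ pred {P = P} {ts} ⟧ = predᴵ P ⟦ ts ⟧ᵗˢ
    ⟦ const {r} ⟧         = fromℚ r
    ⟦ 𝔭 {i} ⟧             = 𝔭ᴵ i
    ⟦ 𝔮 {i} ⟧             = 𝔮ᴵ i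

    ⟦_⟧ᵐ : ∀ {Γ} → All Atom Γ → ℝ
    ⟦ [] ⟧ᵐ     = 0ℝ
    ⟦ F ∷ Γ ⟧ᵐ = (⟦ F ⟧ - 1ℝ) + ⟦ Γ ⟧ᵐ

    AtomicAndTrue : Sequent → Set
    AtomicAndTrue (Γ ⇒ Δ) =
      Σ[ γ ∈ All Atom Γ ] Σ[ δ ∈ All Atom Δ ] 0ℝ ≤ ⟦ δ ⟧ᵐ - ⟦ γ ⟧ᵐ

  -- The existence of a true sequent is classical, whence ¬ ¬: with a bare
  -- Any, even  𝔭 i ⇒ 𝔭 j ∣ 𝔭 j ⇒ 𝔭 i  would require deciding x ≤ y or y ≤ x
  -- for arbitrary reals.
  Axiom : Hypersequent → Set₁
  Axiom H = ∀ M ν → ¬ ¬ Any (AtomicAndTrue M ν) H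

  ----------------------------------------------------------------------
  -- Calculi

  infix 3 ⊢¹_ ⊢²_ ⊢³_

  -- In G¹ and G² every context formula of a conclusion also occurs in the
  -- premises, and all other formulas of a conclusion are RPL∀-formulas, so
  -- excluding the 𝔮 i from axioms excludes them from all provable hypersequents.

  data ⊢¹_ : Hypersequent → Set₁ where
    exchange : ∀ {H H′} → H ≋ H′ → ⊢¹ H → ⊢¹ H′
    axiom    : ∀ {H} → (∀ i → 𝔮 i # H) → Axiom H → ⊢¹ H

    ⟶⇒ : ∀ {G Γ Δ A B} i →
      let H = (rpl (A ⟶ B) ∷ Γ ⇒ Δ) ∷ G in 𝔭 i # H →
      ⊢¹ (𝔭 i ∷ Γ ⇒ Δ) ∷ (rpl B ∷ [] ⇒ 𝔭 i ∷ rpl A ∷ []) ∷ H →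
      ⊢¹ H

    ⇒⟶ : ∀ {G Γ Δ A B} →
      let H = (Γ ⇒ rpl (A ⟶ B) ∷ Δ) ∷ G in
      ⊢¹ (Γ ⇒ Δ) ∷ H →
      ⊢¹ (rpl A ∷ Γ ⇒ rpl B ∷ Δ) ∷ H →
      ⊢¹ H

    ∀⇒ : ∀ {G Γ Δ x A} t → Closed t →
      let H = (rpl (all x A) ∷ Γ ⇒ Δ) ∷ G in
      ⊢¹ (rpl (A [ x ≔ t ]) ∷ Γ ⇒ Δ) ∷ H →
      ⊢¹ H

    ⇒∀ : ∀ {G Γ Δ x A} a →
      let H = (Γ ⇒ rpl (all x A) ∷ Δ) ∷ G in a #ₐ H →
      ⊢¹ (Γ ⇒ rpl (A [ x ≔ param a ]) ∷ Δ) ∷ H →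
      ⊢¹ H

    ⇒∃ : ∀ {G Γ Δ x A} t → Closed t →
      let H = (Γ ⇒ rpl (ex x A) ∷ Δ) ∷ G in
      ⊢¹ (Γ ⇒ rpl (A [ x ≔ t ]) ∷ Δ) ∷ H →
      ⊢¹ H

    ∃⇒ : ∀ {G Γ Δ x A} a →
      let H = (rpl (ex x A) ∷ Γ ⇒ Δ) ∷ G in a #ₐ H →
      ⊢¹ (rpl (A [ x ≔ param a ]) ∷ Γ ⇒ Δ) ∷ H →
      ⊢¹ H

  data ⊢²_ : Hypersequent → Set₁ where
    exchange : ∀ {H H′} → H ≋ H′ → ⊢² H → ⊢² H′
    axiom    : ∀ {H} → (∀ i → 𝔮 i # H) → Axiom H → ⊢² H

    ⟶⇒ : ∀ {G Γ Δ A B} i →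
      let H = (rpl (A ⟶ B) ∷ Γ ⇒ Δ) ∷ G in 𝔭 i # H →
      ⊢² (𝔭 i ∷ Γ ⇒ Δ) ∷ (rpl B ∷ [] ⇒ 𝔭 i ∷ rpl A ∷ []) ∷ G →
      ⊢² H

    ⇒⟶ : ∀ {G Γ Δ A B} →
      ⊢² (Γ ⇒ Δ) ∷ G →
      ⊢² (rpl A ∷ Γ ⇒ rpl B ∷ Δ) ∷ G →
      ⊢² (Γ ⇒ rpl (A ⟶ B) ∷ Δ) ∷ G

    ∀⇒ : ∀ {G Γ Δ x A} t → Closed t →
      let H = (rpl (all x A) ∷ Γ ⇒ Δ) ∷ G in
      ⊢² (rpl (A [ x ≔ t ]) ∷ Γ ⇒ Δ) ∷ H →
      ⊢² H

    ⇒∀ : ∀ {G Γ Δ x A} a →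
      let H = (Γ ⇒ rpl (all x A) ∷ Δ) ∷ G in a #ₐ H →
      ⊢² (Γ ⇒ rpl (A [ x ≔ param a ]) ∷ Δ) ∷ G →
      ⊢² H

    ⇒∃ : ∀ {G Γ Δ x A} t → Closed t →
      let H = (Γ ⇒ rpl (ex x A) ∷ Δ) ∷ G in
      ⊢² (Γ ⇒ rpl (A [ x ≔ t ]) ∷ Δ) ∷ H →
      ⊢² H

    ∃⇒ : ∀ {G Γ Δ x A} a →
      let H = (rpl (ex x A) ∷ Γ ⇒ Δ) ∷ G in a #ₐ H →
      ⊢² (rpl (A [ x ≔ param a ]) ∷ Γ ⇒ Δ) ∷ G →
      ⊢² H

  data ⊢³_ : Hypersequent → Set₁ where
    exchange : ∀ {H H′} → H ≋ H′ → ⊢³ H → ⊢³ H′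
    axiom    : ∀ {H} → Axiom H → ⊢³ H

    ⟶⇒ : ∀ {G Γ Δ A B} i →
      let H = (rpl (A ⟶ B) ∷ Γ ⇒ Δ) ∷ G in 𝔭 i # H →
      ⊢³ (𝔭 i ∷ Γ ⇒ Δ) ∷ (rpl B ∷ [] ⇒ 𝔭 i ∷ rpl A ∷ []) ∷ G →
      ⊢³ H

    ⇒⟶ : ∀ {G Γ Δ A B} →
      ⊢³ (Γ ⇒ Δ) ∷ G →
      ⊢³ (rpl A ∷ Γ ⇒ rpl B ∷ Δ) ∷ G →
      ⊢³ (Γ ⇒ rpl (A ⟶ B) ∷ Δ) ∷ G

    ∀⇒ : ∀ {G Γ Δ x A} i t → Closed t →
      let H = (rpl (all x A) ∷ Γ ⇒ Δ) ∷ G in 𝔭 i # H →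
      ⊢³ (𝔭 i ∷ Γ ⇒ Δ) ∷ (rpl (all x A) ∷ [] ⇒ 𝔭 i ∷ [])
           ∷ (rpl (A [ x ≔ t ]) ∷ [] ⇒ 𝔭 i ∷ []) ∷ G →
      ⊢³ H

    ⇒∀ : ∀ {G Γ Δ x A} a →
      let H = (Γ ⇒ rpl (all x A) ∷ Δ) ∷ G in a #ₐ H →
      ⊢³ (Γ ⇒ rpl (A [ x ≔ param a ]) ∷ Δ) ∷ G →
      ⊢³ H

    ⇒∃ : ∀ {G Γ Δ x A} i t → Closed t →
      let H = (Γ ⇒ rpl (ex x A) ∷ Δ) ∷ G in 𝔮 i # H →
      ⊢³ (Γ ⇒ 𝔮 i ∷ Δ) ∷ (𝔮 i ∷ [] ⇒ rpl (ex x A) ∷ [])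
           ∷ (𝔮 i ∷ [] ⇒ rpl (A [ x ≔ t ]) ∷ []) ∷ G →
      ⊢³ H

    ∃⇒ : ∀ {G Γ Δ x A} a →
      let H = (rpl (ex x A) ∷ Γ ⇒ Δ) ∷ G in a #ₐ H →
      ⊢³ (rpl (A [ x ≔ param a ]) ∷ Γ ⇒ Δ) ∷ G →
      ⊢³ H

  Provable¹ Provable² Provable³ : RPL → Set₁
  Provable¹ A = ⊢¹ [ [] ⇒ [ rpl A ] ]
  Provable² A = ⊢² [ [] ⇒ [ rpl A ] ]
  Provable³ A = ⊢³ [ [] ⇒ [ rpl A ] ]

{-# OPTIONS --safe #-}

-- G¹ to G² and G² to G³, for all formulas: a derivation is replayed against a
-- hypersequent K of the target calculus whose sequents cover those of the source,
-- where a covered sequent has been decomposed in K or cut at a semipropositional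
-- variable.  Rule applications permute with such decompositions, and a cut
-- sequent that is true leaves one of its two parts true, so that axioms of the
-- source make K an axiom.
--
-- G³ to G¹, for a prenex formula A: quantifiers occur in a G³-proof of A only in
-- sequents ⇒ F or 𝔮 ⇒ F with F an instance of A.  Performing only the quantifier
-- steps in G¹, without the 𝔮, collects a set Θ of instances.  If all of Θ had
-- values below 1, values for the 𝔮 and 𝔭 could be chosen that make each sequent of
-- some leaf of the G³-proof false, which is absurd for an axiom.  Hence Θ is valid
-- and its quantifier-free part derivable in G¹.  The two premises of (⇒→)³ are
-- handled by continuing the G¹-derivation for the first with that for the second.

module Submission where

open import Defs
open import Algebra.Bundles using (CommutativeMonoid)
import Algebra.Solver.CommutativeMonoid
open import Data.Empty using (⊥)
import Data.Integer.Base as ℤ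
import Data.Integer.Solver as ℤ-Solver
open import Data.List.Base using (List; []; _∷_; [_]; _++_; map)
open import Data.List.Membership.Propositional using (_∈_)
open import Data.List.Membership.Propositional.Properties using (∈-++⁻; ∈-∃++; ∈-map⁺)
open import Data.List.Properties using (∷-injective; ∷-injectiveˡ)
open import Data.List.Relation.Binary.Permutation.Homogeneous as Perm
  using (Permutation; refl; prep; swap; trans)
open import Data.List.Relation.Binary.Permutation.Propositional as ↭
  using (_↭_; ↭-refl; ↭-sym; ↭-trans)
import Data.List.Relation.Binary.Permutation.Propositional.Properties as ↭ₚ
open import Data.List.Relation.Binary.Pointwise as Pointwise using ([]; _∷_)
open import Data.List.Relation.Binary.Subset.Propositional using (_⊆_)
open import Data.List.Relation.Binary.Subset.Propositional.Properties
  using (Any-resp-⊆; All-resp-⊇; ⊆-refl)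
open import Data.List.Relation.Unary.All as All using (All; []; _∷_)
import Data.List.Relation.Unary.All.Properties as Allₚ
open import Data.List.Relation.Unary.Any as Any using (Any; here; there)
open import Data.Nat.Base as ℕ using (ℕ; zero; suc; _⊔_)
import Data.Nat.Properties as ℕₚ
open import Data.Product.Base using (∃-syntax; _×_; _,_; proj₁; proj₂)
open import Data.Rational.Base as ℚ using (ℚ; mkℚ; 0ℚ; 1ℚ; ½; ∣_∣; toℚᵘ)
  renaming (_+_ to _+ℚ_; _-_ to _-ℚ_; -_ to -ℚ_; _*_ to _*ℚ_; _≤_ to _≤ℚ_; _<_ to _<ℚ_; _⊓_ to _⊓ℚ_)
import Data.Rational.Properties as ℚₚ
open import Data.Rational.Solver using (module +-*-Solver)
open import Data.Rational.Unnormalised.Base as ℚᵘ using (mkℚᵘ; *≡*; *≤*)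
import Data.Rational.Unnormalised.Properties as ℚᵘₚ
open import Data.Sum.Base using (_⊎_; inj₁; inj₂; [_,_]′)
open import Data.Unit.Base using (⊤; tt)
open import Data.Vec.Base using (Vec; []; _∷_)
import Data.Vec.Relation.Unary.All as Vec
import Data.Vec.Relation.Unary.Any as Vec
open import Function.Base using (_∘_; id)
open import Function.Bundles using (_⇔_; mk⇔)
open import Level using (0ℓ)
open import Relation.Binary.PropositionalEquality
  using (_≡_; _≢_; refl; sym; cong; cong₂; subst; subst₂)
  renaming (trans to ≡-trans)
open import Relation.Nullary using (¬_; yes; no; contradiction)
open import Relation.Nullary.Decidable using (decidable-stable; from-no)

-- Rational estimates and the Archimedean property

-- The equation says that b - a ≡ q - p.
≤-shift : ∀ {p q a b} → p ≤ℚ q → b +ℚ p ≡ a +ℚ q → a ≤ℚ b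
≤-shift {p} {q} {a} {b} p≤q eq = begin
  a                   ≡⟨ solve 2 (λ a p → a := (a :+ p) :- p) refl a p ⟩
  (a +ℚ p) -ℚ p       ≤⟨ ℚₚ.+-monoˡ-≤ (-ℚ p) (ℚₚ.+-monoʳ-≤ a p≤q) ⟩
  (a +ℚ q) -ℚ p       ≡⟨ cong (_-ℚ p) (sym eq) ⟩
  (b +ℚ p) -ℚ p       ≡⟨ solve 2 (λ b p → (b :+ p) :- p := b) refl b p ⟩
  b                   ∎
  where open ℚₚ.≤-Reasoning; open +-*-Solver

p≤∣p∣ : ∀ p → p ≤ℚ ∣ p ∣
p≤∣p∣ p with ℚₚ.∣p∣≡p∨∣p∣≡-p p
... | inj₁ eq = ℚₚ.≤-reflexive (sym eq)
... | inj₂ eq with ℚₚ.≤-total 0ℚ p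
...   | inj₁ 0≤p = ℚₚ.≤-reflexive (sym (ℚₚ.0≤p⇒∣p∣≡p 0≤p))
...   | inj₂ p≤0 = ℚₚ.≤-trans p≤0 (ℚₚ.0≤∣p∣ p)

∣∣-least : ∀ {p e} → p ≤ℚ e → -ℚ p ≤ℚ e → ∣ p ∣ ≤ℚ e
∣∣-least {p} {e} h₁ h₂ with ℚₚ.∣p∣≡p∨∣p∣≡-p p
... | inj₁ eq = subst (_≤ℚ e) (sym eq) h₁
... | inj₂ eq = subst (_≤ℚ e) (sym eq) h₂

2^-≥0 : ∀ n → 0ℚ ≤ℚ 2^- n
2^-≥0 zero    = ℚₚ.nonNegative⁻¹ 1ℚ
2^-≥0 (suc n) = subst (_≤ℚ 2^- (suc n)) (ℚₚ.*-zeroʳ ½)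
                  (ℚₚ.*-monoˡ-≤-nonNeg ½ (2^-≥0 n))

infixr 8 _×ℚ_

_×ℚ_ : ℕ → ℚ → ℚ
zero  ×ℚ p = 0ℚ
suc n ×ℚ p = p +ℚ n ×ℚ p

×ℚ-mono : ∀ n {p q} → p ≤ℚ q → n ×ℚ p ≤ℚ n ×ℚ q
×ℚ-mono zero    p≤q = ℚₚ.≤-refl
×ℚ-mono (suc n) p≤q = ℚₚ.+-mono-≤ p≤q (×ℚ-mono n p≤q)

-- Amounts to N ≤ 2^N. In the induction step the first summand is at most one half of `2^- n`, and
-- the remaining N summands together at most the other half.
×ℚ-2^- : ∀ N n → N ×ℚ 2^- (N ℕ.+ n) ≤ℚ 2^- n
×ℚ-2^- zero    n = 2^-≥0 n
×ℚ-2^- (suc N) n = begin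
  2^- (suc N ℕ.+ n) +ℚ N ×ℚ 2^- (suc N ℕ.+ n)
    ≤⟨ ℚₚ.+-mono-≤ (small N n) (subst (λ k → N ×ℚ 2^- k ≤ℚ 2^- (suc n)) (ℕₚ.+-suc N n) (×ℚ-2^- N (suc n))) ⟩
  2^- (suc n) +ℚ 2^- (suc n)
    ≡⟨ solve 1 (λ p → con ½ :* p :+ con ½ :* p := p) refl (2^- n) ⟩
  2^- n ∎
  where
  open ℚₚ.≤-Reasoning
  open +-*-Solver
  small : ∀ N n → 2^- (suc (N ℕ.+ n)) ≤ℚ 2^- (suc n)
  small zero    n = ℚₚ.≤-refl
  small (suc N) n = ℚₚ.≤-trans
    (≤-shift (2^-≥0 (suc (suc (N ℕ.+ n)))) (solve 1 (λ p → p :+ con 0ℚ := con ½ :* p :+ con ½ :* p) refl (2^- (suc (N ℕ.+ n)))))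
    (small N n)

-- Without reduction to lowest terms a multiple of `ε` keeps the denominator of `ε`, so that `1≤×ℚ`
-- comes down to a comparison of naturals.
toℚᵘ-×ℚ : ∀ N (ε : ℚ) → toℚᵘ (N ×ℚ ε) ℚᵘ.≃ mkℚᵘ (ℤ.+ N ℤ.* ℚ.↥ ε) (ℚ.denominator-1 ε)
toℚᵘ-×ℚ zero    ε@(mkℚ m d _) = *≡* refl
toℚᵘ-×ℚ (suc N) ε@(mkℚ m d _) = ℚᵘₚ.≃-trans (ℚₚ.toℚᵘ-homo-+ ε (N ×ℚ ε))
  (ℚᵘₚ.≃-trans (ℚᵘₚ.+-congʳ (toℚᵘ ε) (toℚᵘ-×ℚ N ε))
    (*≡* (solve 3 (λ m N d → (m :* d :+ N :* m :* d) :* d := ((con (ℤ.+ 1) :+ N) :* m) :* (d :* d))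
       refl m (ℤ.+ N) (ℤ.+ suc d))))
  where open ℤ-Solver.+-*-Solver

1≤×ℚ : ∀ {ε} → 0ℚ <ℚ ε → ∃[ N ] 1ℚ ≤ℚ N ×ℚ ε
1≤×ℚ {mkℚ (ℤ.+ zero) d _} (ℚ.*<* (ℤ.+<+ ()))
-- The denominator of `ε` is `suc d`; that many copies of `ε` add up to its numerator, which is at
-- least 1.
1≤×ℚ {ε@(mkℚ ℤ.+[1+ m ] d _)} _ = suc d , ℚₚ.toℚᵘ-cancel-≤
  (ℚᵘₚ.≤-respʳ-≃ (ℚᵘₚ.≃-sym (toℚᵘ-×ℚ (suc d) ε))
    (*≤* (ℤ.+≤+ (subst₂ ℕ._≤_ (sym (ℕₚ.*-identityˡ (suc d))) (sym (ℕₚ.*-identityʳ _))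
      (ℕₚ.m≤m*n (suc d) (suc m))))))
1≤×ℚ {mkℚ ℤ.-[1+ m ] d _} (ℚ.*<* ())

-- Lets the estimates below pass to an arbitrarily late index k and then discard the error made
-- there. If a > b, some multiple N (a - b) is at least 1, but a large k makes it at most 1/2.
archimedean : ∀ C {a b} → (∀ k → a ≤ℚ b +ℚ C ×ℚ 2^- k) → a ≤ℚ b
archimedean C {a} {b} h with a ℚₚ.≤? b
... | yes a≤b = a≤b
... | no  a≰b = contradiction (begin-strict
    1ℚ                                      ≤⟨ proj₂ large ⟩
    -- In the index C + (N + 1), the summand C absorbs the factor C, N absorbs the factor N, and 1
    -- leaves `2^- 1`.
    N ×ℚ (a -ℚ b)                           ≤⟨ ×ℚ-mono N (bound (C ℕ.+ (N ℕ.+ 1))) ⟩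
    N ×ℚ (C ×ℚ 2^- (C ℕ.+ (N ℕ.+ 1)))       ≤⟨ ×ℚ-mono N (×ℚ-2^- C (N ℕ.+ 1)) ⟩
    N ×ℚ 2^- (N ℕ.+ 1)                      ≤⟨ ×ℚ-2^- N 1 ⟩
    2^- 1                                   <⟨ ℚ.*<* (ℤ.+<+ (ℕ.s≤s (ℕ.s≤s ℕ.z≤n))) ⟩
    1ℚ                                      ∎) (ℚₚ.<-irrefl refl)
  where
  open ℚₚ.≤-Reasoning
  open +-*-Solver
  large : ∃[ N ] 1ℚ ≤ℚ N ×ℚ (a -ℚ b)
  large = 1≤×ℚ (subst (_<ℚ a -ℚ b) (ℚₚ.+-inverseʳ b) (ℚₚ.+-monoˡ-< (-ℚ b) (ℚₚ.≰⇒> a≰b)))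
  N = proj₁ large
  bound : ∀ k → a -ℚ b ≤ℚ C ×ℚ 2^- k
  bound k = ≤-shift (h k) (solve 3 (λ a b c → c :+ a := (a :- b) :+ (b :+ c)) refl a b (C ×ℚ 2^- k))

-- The order of the reals

seq-close : ∀ x m n → seq x m ≤ℚ seq x n +ℚ (2^- m +ℚ 2^- n)
seq-close x m n = ≤-shift (ℚₚ.≤-trans (p≤∣p∣ _) (regular x m n))
  (solve 3 (λ a b c → (b :+ c) :+ (a :- b) := a :+ c) refl (seq x m) (seq x n) (2^- m +ℚ 2^- n))
  where open +-*-Solver

infix 4 _⊑_ _≃_

-- _≤_ unfolds to a statement on seq x and seq y, from which Agda cannot infer
-- x and y; the record keeps them visible.
record _⊑_ (x y : ℝ) : Set where
  constructor ≤⇒⊑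
  field ⊑⇒≤ : x ≤ y

open _⊑_ public

_≃_ : ℝ → ℝ → Set
x ≃ y = x ⊑ y × y ⊑ x

⊑-refl : ∀ {x} → x ⊑ x
⊑-refl {x} .⊑⇒≤ n = ≤-shift (ℚₚ.+-mono-≤ (2^-≥0 n) (2^-≥0 n)) (ℚₚ.+-identityʳ _)

-- Chaining the hypotheses at index n itself would double the permitted error. They are chained at a
-- late index k instead, where the six errors `2^- k` are negligible.
⊑-trans : ∀ {x y z} → x ⊑ y → y ⊑ z → x ⊑ z
⊑-trans {x} {y} {z} (≤⇒⊑ p) (≤⇒⊑ q) .⊑⇒≤ n = archimedean 6 λ k → begin
  seq x n   ≤⟨ seq-close x n k ⟩
  seq x k +ℚ (2^- n +ℚ 2^- k)
    ≤⟨ ℚₚ.+-monoˡ-≤ _ (p k) ⟩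
  seq y k +ℚ (2^- k +ℚ 2^- k) +ℚ (2^- n +ℚ 2^- k)
    ≤⟨ ℚₚ.+-monoˡ-≤ _ (ℚₚ.+-monoˡ-≤ _ (q k)) ⟩
  seq z k +ℚ (2^- k +ℚ 2^- k) +ℚ (2^- k +ℚ 2^- k) +ℚ (2^- n +ℚ 2^- k)
    ≤⟨ ℚₚ.+-monoˡ-≤ _ (ℚₚ.+-monoˡ-≤ _ (ℚₚ.+-monoˡ-≤ _ (seq-close z k n))) ⟩
  seq z n +ℚ (2^- k +ℚ 2^- n) +ℚ (2^- k +ℚ 2^- k) +ℚ (2^- k +ℚ 2^- k) +ℚ (2^- n +ℚ 2^- k)
    ≡⟨ solve 3 (λ z n k → z :+ (k :+ n) :+ (k :+ k) :+ (k :+ k) :+ (n :+ k) :=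
         z :+ (n :+ n) :+ (k :+ (k :+ (k :+ (k :+ (k :+ (k :+ con 0ℚ))))))) refl (seq z n) (2^- n) (2^- k) ⟩
  seq z n +ℚ (2^- n +ℚ 2^- n) +ℚ 6 ×ℚ 2^- k ∎
  where open ℚₚ.≤-Reasoning; open +-*-Solver

-- An inequality of reals is a family of decidable inequalities of rationals, so it may be proved
-- classically.
⊑-stable : ∀ {x y} → ¬ ¬ (x ⊑ y) → x ⊑ y
⊑-stable ¬¬p .⊑⇒≤ n = decidable-stable (_ ℚₚ.≤? _) λ ¬q → ¬¬p λ p → ¬q (⊑⇒≤ p n)

⋢-witness : ∀ {x y} → ¬ (x ⊑ y) → ¬ ¬ (∃[ n ] seq y n +ℚ (2^- n +ℚ 2^- n) <ℚ seq x n)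
⋢-witness ¬p ¬w = ¬p (≤⇒⊑ λ n → ℚₚ.≮⇒≥ λ lt → ¬w (n , lt))

-- A constant sequence has no error of its own, so the slack in the definition of `_≤_` halves.
-- `between` depends on this sharper bound.
⊑fromℚ⇒ : ∀ {x r} → x ⊑ fromℚ r → ∀ n → seq x n ≤ℚ r +ℚ 2^- n
⊑fromℚ⇒ {x} {r} (≤⇒⊑ p) n = archimedean 3 λ k → begin
  seq x n                                           ≤⟨ seq-close x n k ⟩
  seq x k +ℚ (2^- n +ℚ 2^- k)                       ≤⟨ ℚₚ.+-monoˡ-≤ _ (p k) ⟩
  r +ℚ (2^- k +ℚ 2^- k) +ℚ (2^- n +ℚ 2^- k)
    ≡⟨ solve 3 (λ r n k → r :+ (k :+ k) :+ (n :+ k) := r :+ n :+ (k :+ (k :+ (k :+ con 0ℚ)))) refl r (2^- n) (2^- k) ⟩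
  r +ℚ 2^- n +ℚ 3 ×ℚ 2^- k ∎
  where open ℚₚ.≤-Reasoning; open +-*-Solver

fromℚ⊑⇒ : ∀ {x r} → fromℚ r ⊑ x → ∀ n → r ≤ℚ seq x n +ℚ 2^- n
fromℚ⊑⇒ {x} {r} (≤⇒⊑ p) n = archimedean 3 λ k → begin
  r                                                 ≤⟨ p k ⟩
  seq x k +ℚ (2^- k +ℚ 2^- k)                       ≤⟨ ℚₚ.+-monoˡ-≤ _ (seq-close x k n) ⟩
  seq x n +ℚ (2^- k +ℚ 2^- n) +ℚ (2^- k +ℚ 2^- k)
    ≡⟨ solve 3 (λ x n k → x :+ (k :+ n) :+ (k :+ k) := x :+ n :+ (k :+ (k :+ (k :+ con 0ℚ)))) refl (seq x n) (2^- n) (2^- k) ⟩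
  seq x n +ℚ 2^- n +ℚ 3 ×ℚ 2^- k ∎
  where open ℚₚ.≤-Reasoning; open +-*-Solver

-- If `x ⊑ y` fails, x exceeds y at some index n by more than twice `2^- n`. Passing from n to any k
-- costs at most `2^- n + 2^- k` for each of x and y, which leaves only the permitted slack.
⊑-total : ∀ x y → ¬ ¬ (x ⊑ y ⊎ y ⊑ x)
⊑-total x y ¬t = ⋢-witness (λ p → ¬t (inj₁ p)) λ { (n , lt) → ¬t (inj₂ (≤⇒⊑ λ k → begin
  seq y k                                            ≤⟨ seq-close y k n ⟩
  seq y n +ℚ (2^- k +ℚ 2^- n)
    ≡⟨ solve 3 (λ y k n → y :+ (k :+ n) := y :+ (n :+ n) :+ (k :- n)) refl (seq y n) (2^- k) (2^- n) ⟩
  seq y n +ℚ (2^- n +ℚ 2^- n) +ℚ (2^- k -ℚ 2^- n)    ≤⟨ ℚₚ.+-monoˡ-≤ _ (ℚₚ.<⇒≤ lt) ⟩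
  seq x n +ℚ (2^- k -ℚ 2^- n)                        ≤⟨ ℚₚ.+-monoˡ-≤ _ (seq-close x n k) ⟩
  seq x k +ℚ (2^- n +ℚ 2^- k) +ℚ (2^- k -ℚ 2^- n)
    ≡⟨ solve 3 (λ x k n → x :+ (n :+ k) :+ (k :- n) := x :+ (k :+ k)) refl (seq x k) (2^- k) (2^- n) ⟩
  seq x k +ℚ (2^- k +ℚ 2^- k) ∎)) }
  where open ℚₚ.≤-Reasoning; open +-*-Solver

⋢⇒⊒ : ∀ {x y} → ¬ (x ⊑ y) → y ⊑ x
⋢⇒⊒ {x} {y} ¬p = ⊑-stable λ ¬q → ⊑-total x y [ ¬p , ¬q ]′

-- Negated inequalities express strictness. At the witnessing index the gap exceeds twice the error,
-- so the midpoint of the two approximations separates x from y.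
between : ∀ {x y} → ¬ (x ⊑ y) → ¬ ¬ (∃[ r ] ¬ (x ⊑ fromℚ r) × ¬ (fromℚ r ⊑ y))
between {x} {y} ¬p ¬w = ⋢-witness ¬p λ { (n , lt) →
  let a = seq x n; b = seq y n; e = 2^- n; r = ½ *ℚ (a +ℚ b) in
  ¬w (r ,
    (λ x≤r → ℚₚ.<-irrefl refl (ℚₚ.<-≤-trans lt (≤-shift (ℚₚ.+-mono-≤ (⊑fromℚ⇒ x≤r n) (⊑fromℚ⇒ x≤r n))
      (solve 3 (λ a b e → (b :+ (e :+ e)) :+ (a :+ a) :=
        a :+ ((con ½ :* (a :+ b) :+ e) :+ (con ½ :* (a :+ b) :+ e))) refl a b e)))) ,
    (λ r≤y → ℚₚ.<-irrefl refl (ℚₚ.<-≤-trans lt (≤-shift (ℚₚ.+-mono-≤ (fromℚ⊑⇒ r≤y n) (fromℚ⊑⇒ r≤y n))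
      (solve 3 (λ a b e → (b :+ (e :+ e)) :+ (con ½ :* (a :+ b) :+ con ½ :* (a :+ b)) :=
        a :+ ((b :+ e) :+ (b :+ e))) refl a b e))))) }
  where open +-*-Solver

-- Arithmetic of the reals up to `_≃_`

≃-refl : ∀ {x} → x ≃ x
≃-refl = ⊑-refl , ⊑-refl

≃-sym : ∀ {x y} → x ≃ y → y ≃ x
≃-sym (p , q) = q , p

≃-trans : ∀ {x y z} → x ≃ y → y ≃ z → x ≃ z
≃-trans (p , p′) (q , q′) = ⊑-trans p q , ⊑-trans q′ p′

≡⇒≃ : ∀ {x y} → x ≡ y → x ≃ y
≡⇒≃ refl = ≃-refl

seq-≡⇒⊑ : ∀ {x y} → (∀ n → seq x n ≡ seq y n) → x ⊑ y
seq-≡⇒⊑ {x} {y} eq .⊑⇒≤ n =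
  subst (_≤ℚ seq y n +ℚ (2^- n +ℚ 2^- n)) (sym (eq n)) (⊑⇒≤ (⊑-refl {y}) n)

seq-≡⇒≃ : ∀ {x y} → (∀ n → seq x n ≡ seq y n) → x ≃ y
seq-≡⇒≃ eq = seq-≡⇒⊑ eq , seq-≡⇒⊑ λ n → sym (eq n)

⊓ℚ-close : ∀ {a b} c d e → a ≤ℚ c +ℚ e → b ≤ℚ d +ℚ e → a ⊓ℚ b ≤ℚ (c ⊓ℚ d) +ℚ e
⊓ℚ-close {a} {b} c d e p q = subst (a ⊓ℚ b ≤ℚ_)
  (sym (ℚₚ.mono-≤-distrib-⊓ {f = _+ℚ e} (λ {x} {y} x≤y → ℚₚ.+-monoˡ-≤ e x≤y) c d))
  (ℚₚ.⊓-mono-≤ p q)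

-- Transparent operations would make Agda compare reals componentwise, including
-- the proofs of regularity.
opaque
  infixl 6 _⊹_ _⊟_
  infixl 7 _⊓_

  _⊹_ _⊟_ _⊓_ : ℝ → ℝ → ℝ
  _⊹_ = _+_
  _⊟_ = _-_
  (x ⊓ y) .seq     n   = seq x n ⊓ℚ seq y n
  (x ⊓ y) .regular m n = ∣∣-least
    (≤-shift (⊓ℚ-close (seq x n) (seq y n) (2^- m +ℚ 2^- n) (seq-close x m n) (seq-close y m n))
      (solve 3 (λ a b e → e :+ a := (a :- b) :+ (b :+ e)) refl
        (seq x m ⊓ℚ seq y m) (seq x n ⊓ℚ seq y n) (2^- m +ℚ 2^- n)))
    (≤-shift (⊓ℚ-close (seq x m) (seq y m) (2^- n +ℚ 2^- m) (seq-close x n m) (seq-close y n m))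
      (solve 4 (λ a b e f → (e :+ f) :+ b := (:- (a :- b)) :+ (a :+ (f :+ e))) refl
        (seq x m ⊓ℚ seq y m) (seq x n ⊓ℚ seq y n) (2^- m) (2^- n)))
    where open +-*-Solver

  ⊹-def : ∀ x y → x + y ≡ x ⊹ y
  ⊹-def x y = refl

  ⊟-def : ∀ x y → x - y ≡ x ⊟ y
  ⊟-def x y = refl

  x⊓y⊑x : ∀ x y → x ⊓ y ⊑ x
  x⊓y⊑x x y .⊑⇒≤ n = ℚₚ.≤-trans (ℚₚ.p⊓q≤p (seq x n) (seq y n)) (⊑⇒≤ (⊑-refl {x}) n)

  x⊓y⊑y : ∀ x y → x ⊓ y ⊑ y
  x⊓y⊑y x y .⊑⇒≤ n = ℚₚ.≤-trans (ℚₚ.p⊓q≤q (seq x n) (seq y n)) (⊑⇒≤ (⊑-refl {y}) n)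

  ⊓-glb : ∀ {x y z} → z ⊑ x → z ⊑ y → z ⊑ x ⊓ y
  ⊓-glb {x} {y} {z} (≤⇒⊑ p) (≤⇒⊑ q) .⊑⇒≤ n = begin
    seq z n                                 ≡⟨ sym (ℚₚ.⊓-idem (seq z n)) ⟩
    seq z n ⊓ℚ seq z n                      ≤⟨ ⊓ℚ-close (seq x n) (seq y n) (2^- n +ℚ 2^- n) (p n) (q n) ⟩
    (seq x n ⊓ℚ seq y n) +ℚ (2^- n +ℚ 2^- n) ∎
    where open ℚₚ.≤-Reasoning

  ⊹-mono : ∀ {x y x′ y′} → x ⊑ y → x′ ⊑ y′ → x ⊹ x′ ⊑ y ⊹ y′
  ⊹-mono {x} {y} {x′} {y′} (≤⇒⊑ p) (≤⇒⊑ q) .⊑⇒≤ n = ≤-shift (ℚₚ.+-mono-≤ (p (suc n)) (q (suc n)))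
    (solve 5 (λ a b c d e → ((c :+ d) :+ (e :+ e)) :+ (a :+ b) :=
       (a :+ b) :+ ((c :+ (con ½ :* e :+ con ½ :* e)) :+ (d :+ (con ½ :* e :+ con ½ :* e)))) refl
       (seq x (suc n)) (seq x′ (suc n)) (seq y (suc n)) (seq y′ (suc n)) (2^- n))
    where open +-*-Solver

  ⊹-comm : ∀ x y → x ⊹ y ≃ y ⊹ x
  ⊹-comm x y = seq-≡⇒≃ λ n → ℚₚ.+-comm (seq x (suc n)) (seq y (suc n))

  ⊹-identityˡ : ∀ x → 0ℝ ⊹ x ≃ x
  ⊹-identityˡ x =
    ≤⇒⊑ (λ n → ≤-shift (ℚₚ.+-mono-≤ (seq-close x (suc n) n) (2^-≥0 (suc n)))
      (solve 3 (λ a b e → (a :+ (e :+ e)) :+ (b :+ con 0ℚ) :=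
        (con 0ℚ :+ b) :+ ((a :+ (con ½ :* e :+ e)) :+ con ½ :* e)) refl (seq x n) (seq x (suc n)) (2^- n))) ,
    ≤⇒⊑ (λ n → ≤-shift (ℚₚ.+-mono-≤ (seq-close x n (suc n)) (2^-≥0 (suc n)))
      (solve 3 (λ a b e → ((con 0ℚ :+ b) :+ (e :+ e)) :+ (a :+ con 0ℚ) :=
        a :+ ((b :+ (e :+ con ½ :* e)) :+ con ½ :* e)) refl (seq x n) (seq x (suc n)) (2^- n)))
    where open +-*-Solver

  -- Not a termwise identity: every addition shifts the index by one, so x and z are approximated at
  -- different indices on the two sides.
  ⊹-assoc-⊑ : ∀ x y z → (x ⊹ y) ⊹ z ⊑ x ⊹ (y ⊹ z)
  ⊹-assoc-⊑ x y z .⊑⇒≤ n = ≤-shift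
    (ℚₚ.+-mono-≤ (ℚₚ.+-mono-≤ (seq-close x (suc (suc n)) (suc n)) (seq-close z (suc n) (suc (suc n))))
                 (2^-≥0 (suc n)))
    (solve 6 (λ a b c d f e →
       ((b :+ (f :+ d)) :+ (e :+ e)) :+ ((a :+ c) :+ con 0ℚ) :=
       ((a :+ f) :+ c) :+ (((b :+ (con ½ :* (con ½ :* e) :+ con ½ :* e)) :+
                            (d :+ (con ½ :* e :+ con ½ :* (con ½ :* e)))) :+ con ½ :* e)) refl
       (seq x (suc (suc n))) (seq x (suc n)) (seq z (suc n)) (seq z (suc (suc n)))
       (seq y (suc (suc n))) (2^- n))
    where open +-*-Solver

  ⊟-cancel : ∀ x y → (x ⊟ y) ⊹ y ≃ x
  ⊟-cancel x y =
    ≤⇒⊑ (λ n → ≤-shift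
      (ℚₚ.+-mono-≤ (ℚₚ.+-mono-≤ (seq-close x (suc (suc n)) n) (seq-close y (suc n) (suc (suc n)))) (ℚₚ.≤-refl {0ℚ}))
      (solve 5 (λ a b c d e → (b :+ (e :+ e)) :+ ((a :+ c) :+ con 0ℚ) :=
        ((a :+ (:- d)) :+ c) :+ (((b :+ (con ½ :* (con ½ :* e) :+ e)) :+ (d :+ (con ½ :* e :+ con ½ :* (con ½ :* e)))) :+ con 0ℚ))
        refl (seq x (suc (suc n))) (seq x n) (seq y (suc n)) (seq y (suc (suc n))) (2^- n))) ,
    ≤⇒⊑ (λ n → ≤-shift
      (ℚₚ.+-mono-≤ (ℚₚ.+-mono-≤ (seq-close x n (suc (suc n))) (seq-close y (suc (suc n)) (suc n))) (ℚₚ.≤-refl {0ℚ}))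
      (solve 5 (λ a b c d e → (((a :+ (:- d)) :+ c) :+ (e :+ e)) :+ ((b :+ d) :+ con 0ℚ) :=
        b :+ (((a :+ (e :+ con ½ :* (con ½ :* e))) :+ (c :+ (con ½ :* (con ½ :* e) :+ con ½ :* e))) :+ con 0ℚ))
        refl (seq x (suc (suc n))) (seq x n) (seq y (suc n)) (seq y (suc (suc n))) (2^- n)))
    where open +-*-Solver

  fromℚ-⊟ : ∀ p q → fromℚ p ⊟ fromℚ q ≃ fromℚ (p -ℚ q)
  fromℚ-⊟ p q = seq-≡⇒≃ λ n → refl

⊹-cong : ∀ {x y x′ y′} → x ≃ y → x′ ≃ y′ → x ⊹ x′ ≃ y ⊹ y′
⊹-cong (p , p′) (q , q′) = ⊹-mono p q , ⊹-mono p′ q′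

⊹-assoc : ∀ x y z → (x ⊹ y) ⊹ z ≃ x ⊹ (y ⊹ z)
⊹-assoc x y z = ⊹-assoc-⊑ x y z ,
  ⊑-trans (proj₁ (⊹-comm x (y ⊹ z))) (⊑-trans (⊹-mono (proj₁ (⊹-comm y z)) ⊑-refl)
    (⊑-trans (⊹-assoc-⊑ z y x) (⊑-trans (proj₁ (⊹-comm z (y ⊹ x))) (⊹-mono (proj₁ (⊹-comm y x)) ⊑-refl))))

⊹-commutativeMonoid : CommutativeMonoid 0ℓ 0ℓ
⊹-commutativeMonoid = record
  { Carrier = ℝ ; _≈_ = _≃_ ; _∙_ = _⊹_ ; ε = 0ℝ
  ; isCommutativeMonoid = record
    { isMonoid = record
      { isSemigroup = record
        { isMagma = record
          { isEquivalence = record { refl = ≃-refl ; sym = ≃-sym ; trans = ≃-trans }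
          ; ∙-cong        = ⊹-cong }
        ; assoc = ⊹-assoc }
      ; identity = ⊹-identityˡ , λ x → ≃-trans (⊹-comm x 0ℝ) (⊹-identityˡ x) }
    ; comm = ⊹-comm } }

module ℝ-Solver = Algebra.Solver.CommutativeMonoid ⊹-commutativeMonoid

⊹-cancelʳ : ∀ z {a b} → a ⊹ z ⊑ b ⊹ z → a ⊑ b
⊹-cancelʳ z {a} {b} p = ⊑-trans (proj₂ (undo a)) (⊑-trans (⊹-mono p ⊑-refl) (proj₁ (undo b)))
  where
  undo : ∀ a → (a ⊹ z) ⊹ (0ℝ ⊟ z) ≃ a
  undo a = ≃-trans (⊹-assoc a z (0ℝ ⊟ z))
    (≃-trans (⊹-cong ≃-refl (≃-trans (⊹-comm z (0ℝ ⊟ z)) (⊟-cancel 0ℝ z)))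
      (≃-trans (⊹-comm a 0ℝ) (⊹-identityˡ a)))

-- z collects the terms that cancel when the two inequalities are added.
combine : ∀ z {a b l r l′ r′} → l ⊑ r → l′ ⊑ r′ →
          a ⊹ z ≃ l ⊹ l′ → r ⊹ r′ ≃ b ⊹ z → a ⊑ b
combine z p q eq₁ eq₂ = ⊹-cancelʳ z (⊑-trans (proj₁ eq₁) (⊑-trans (⊹-mono p q) (proj₁ eq₂)))

0⊑⊟⇒⊑ : ∀ {x y} → 0ℝ ⊑ y ⊟ x → x ⊑ y
0⊑⊟⇒⊑ {x} {y} p = ⊑-trans (proj₂ (⊹-identityˡ x)) (⊑-trans (⊹-mono p ⊑-refl) (proj₁ (⊟-cancel y x)))

⊑⇒0⊑⊟ : ∀ {x y} → x ⊑ y → 0ℝ ⊑ y ⊟ x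
⊑⇒0⊑⊟ {x} {y} p = ⊹-cancelʳ x (⊑-trans (proj₁ (⊹-identityˡ x)) (⊑-trans p (proj₂ (⊟-cancel y x))))

-- The truth of sequents is defined with the transparent operations; this lemma and the next carry
-- it over to the opaque ones.
+-≡ : ∀ {x y x′ y′} → x ≡ x′ → y ≡ y′ → x + y ≡ x′ ⊹ y′
+-≡ {x} {y} refl refl = ⊹-def x y

minus-≡ : ∀ {x y x′ y′} → x ≡ x′ → y ≡ y′ → x - y ≡ x′ ⊟ y′
minus-≡ {x} {y} refl refl = ⊟-def x y

⊑⊟⇒⊹⊑ : ∀ {x y z} → x ⊑ y ⊟ z → x ⊹ z ⊑ y
⊑⊟⇒⊹⊑ {x} {y} {z} p = ⊑-trans (⊹-mono p ⊑-refl) (proj₁ (⊟-cancel y z))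

⊹⊑⇒⊑⊟ : ∀ {x y z} → x ⊹ z ⊑ y → x ⊑ y ⊟ z
⊹⊑⇒⊑⊟ {x} {y} {z} p = ⊹-cancelʳ z (⊑-trans p (proj₂ (⊟-cancel y z)))

⊟⊑⇒⊑⊹ : ∀ {x y z} → x ⊟ z ⊑ y → x ⊑ y ⊹ z
⊟⊑⇒⊑⊹ {x} {y} {z} p = ⊑-trans (proj₂ (⊟-cancel x z)) (⊹-mono p ⊑-refl)

⊑⊹⇒⊟⊑ : ∀ {x y z} → x ⊑ y ⊹ z → x ⊟ z ⊑ y
⊑⊹⇒⊟⊑ {x} {y} {z} p = ⊹-cancelʳ z (⊑-trans (proj₁ (⊟-cancel x z)) p)

⊹-identityʳ : ∀ x → x ⊹ 0ℝ ≃ x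
⊹-identityʳ x = ≃-trans (⊹-comm x 0ℝ) (⊹-identityˡ x)

fromℚ-mono : ∀ {p q} → p ≤ℚ q → fromℚ p ⊑ fromℚ q
fromℚ-mono {p} {q} p≤q .⊑⇒≤ n = ℚₚ.≤-trans p≤q (⊑⇒≤ (⊑-refl {fromℚ q}) n)

⊟1⊑0⇒≤1 : ∀ {x} → x ⊟ 1ℝ ⊑ 0ℝ → x ≤ 1ℝ
⊟1⊑0⇒≤1 p = ⊑⇒≤ (⊑-trans (⊟⊑⇒⊑⊹ p) (proj₁ (⊹-identityˡ 1ℝ)))

≤1⇒⊟1⊑0 : ∀ {x} → x ≤ 1ℝ → x ⊟ 1ℝ ⊑ 0ℝ
≤1⇒⊟1⊑0 p = ⊑⊹⇒⊟⊑ (⊑-trans (≤⇒⊑ p) (proj₂ (⊹-identityˡ 1ℝ)))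

-1⊑⊟1⇒≥0 : ∀ {x} → 0ℝ ⊟ 1ℝ ⊑ x ⊟ 1ℝ → 0ℝ ≤ x
-1⊑⊟1⇒≥0 {x} p = ⊑⇒≤ (⊑-trans (⊟⊑⇒⊑⊹ p) (proj₁ (⊟-cancel x 1ℝ)))

+1-⊟1 : ∀ r → fromℚ (r +ℚ 1ℚ) ⊟ 1ℝ ≃ fromℚ r
+1-⊟1 r = ≃-trans (fromℚ-⊟ (r +ℚ 1ℚ) 1ℚ)
  (≡⇒≃ (cong fromℚ (solve 1 (λ r → (r :+ con 1ℚ) :- con 1ℚ := r) refl r)))
  where open +-*-Solver

0⋢-1 : ¬ (0ℝ ⊑ 0ℝ ⊟ 1ℝ)
0⋢-1 p = from-no (1ℚ ℚₚ.≤? 0ℚ +ℚ 2^- 1)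
  (fromℚ⊑⇒ (⊑-trans (proj₂ (⊹-identityˡ 1ℝ)) (⊑⊟⇒⊹⊑ p)) 1)

-- By induction on the bounds: of the rational found so far and the one separating x from the next
-- bound, the larger lies above all bounds and still below x.
between-all : ∀ {x v₀ vs} → ¬ (x ⊑ v₀) → All (λ v → ¬ (x ⊑ v)) vs →
  ¬ ¬ (∃[ r ] ¬ (x ⊑ fromℚ r) × All (λ v → ¬ (fromℚ r ⊑ v)) (v₀ ∷ vs))
between-all x⋢v₀ []                        ¬w = between x⋢v₀ λ { (r , p , q) → ¬w (r , p , q ∷ []) }
between-all {vs = v ∷ vs} x⋢v₀ (x⋢v ∷ x⋢vs) ¬w = between-all x⋢v₀ x⋢vs λ { (r , p , q₀ ∷ qs) →
  between x⋢v λ { (r′ , p′ , q′) → [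
    (λ r≤r′ → ¬w (r′ , p′ , (λ h → q₀ (⊑-trans (fromℚ-mono r≤r′) h)) ∷ q′ ∷
                All.map (λ q h → q (⊑-trans (fromℚ-mono r≤r′) h)) qs)) ,
    (λ r′≤r → ¬w (r , p , q₀ ∷ (λ h → q′ (⊑-trans (fromℚ-mono r′≤r) h)) ∷ qs)) ]′ (ℚₚ.≤-total r r′) } }

-- Updates of functions, maxima and permutations of lists

_[_↦_] : {A : Set} → (ℕ → A) → ℕ → A → ℕ → A
(f [ a ↦ b ]) k with a ℕₚ.≟ k
... | yes _ = b
... | no  _ = f k

↦-same : {A : Set} (f : ℕ → A) (a : ℕ) (b : A) → (f [ a ↦ b ]) a ≡ b
↦-same f a b with a ℕₚ.≟ a
... | yes _   = refl
... | no  a≢a = contradiction refl a≢a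

↦-other : {A : Set} (f : ℕ → A) (a : ℕ) {k : ℕ} (b : A) → a ≢ k → (f [ a ↦ b ]) k ≡ f k
↦-other f a {k} b a≢k with a ℕₚ.≟ k
... | yes a≡k = contradiction a≡k a≢k
... | no  _   = refl

↦-elim : ∀ {A : Set} (R : A → Set) (f : ℕ → A) a b → R b → (∀ k → R (f k)) → ∀ k → R ((f [ a ↦ b ]) k)
↦-elim R f a b Rb Rf k with a ℕₚ.≟ k
... | yes _ = Rb
... | no  _ = Rf k

max : {A : Set} → (A → ℕ) → List A → ℕ
max f []       = 0
max f (x ∷ xs) = f x ⊔ max f xs

max-bound : ∀ {A : Set} {P : A → Set} {f : A → ℕ} {n} → (∀ {x} → P x → n ℕ.≤ f x) →
            ∀ {xs} → Any P xs → n ℕ.≤ max f xs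
max-bound {f = f} b {x ∷ xs} (here px) = ℕₚ.≤-trans (b px) (ℕₚ.m≤m⊔n (f x) (max f xs))
max-bound {f = f} b {x ∷ xs} (there p) = ℕₚ.≤-trans (max-bound b p) (ℕₚ.m≤n⊔m (f x) (max f xs))

∷↭++⁻ : ∀ {A : Set} {x : A} {xs} ys {zs} → x ∷ xs ↭ ys ++ zs →
  (∃[ ys′ ] ys ↭ x ∷ ys′ × xs ↭ ys′ ++ zs) ⊎ (∃[ zs′ ] zs ↭ x ∷ zs′ × xs ↭ ys ++ zs′)
∷↭++⁻ {x = x} ys {zs} p with ∈-++⁻ ys (↭ₚ.∈-resp-↭ p (here refl))
... | inj₁ x∈ys with ∈-∃++ x∈ys
...   | us , vs , refl = inj₁ (us ++ vs , ↭ₚ.shift x us vs ,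
          ↭ₚ.drop-∷ (↭-trans p (↭ₚ.++⁺ʳ zs (↭ₚ.shift x us vs))))
∷↭++⁻ {x = x} ys {zs} p | inj₂ x∈zs with ∈-∃++ x∈zs
...   | us , vs , refl = inj₂ (us ++ vs , ↭ₚ.shift x us vs ,
          ↭ₚ.drop-∷ (↭-trans p (↭-trans (↭ₚ.++⁺ˡ ys (↭ₚ.shift x us vs)) (↭ₚ.shift x ys (us ++ vs)))))

Permutation-All : ∀ {A : Set} {R : A → A → Set} {P : A → Set} → (∀ {x y} → R x y → P x → P y) →
  ∀ {xs ys} → Permutation R xs ys → All P xs → All P ys
Permutation-All f (refl [])       []           = []
Permutation-All f (refl (e ∷ es)) (p ∷ ps)     = f e p ∷ Permutation-All f (refl es) ps
Permutation-All f (prep e es)     (p ∷ ps)     = f e p ∷ Permutation-All f es ps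
Permutation-All f (swap e e′ es)  (p ∷ q ∷ ps) = f e′ q ∷ f e p ∷ Permutation-All f es ps
Permutation-All f (trans es es′)  ps           = Permutation-All f es′ (Permutation-All f es ps)

-- Renaming of parameters and variables

module Syntax (Sg : Signature) where
  open Signature Sg
  open Calculi Sg

  mutual
    renameTerm : (ℕ → ℕ) → Term → Term
    renameTerm π (var x)    = var x
    renameTerm π (param a)  = param (π a)
    renameTerm π (fun f ts) = fun f (renameTerms π ts)

    renameTerms : ∀ {n} → (ℕ → ℕ) → Vec Term n → Vec Term n
    renameTerms π []       = []
    renameTerms π (t ∷ ts) = renameTerm π t ∷ renameTerms π ts

  renameRPL : (ℕ → ℕ) → RPL → RPL
  renameRPL π (pred P ts)         = pred P (renameTerms π ts)
  renameRPL π (const r 0≤r r≤1)   = const r 0≤r r≤1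
  renameRPL π (A ⟶ B)             = renameRPL π A ⟶ renameRPL π B
  renameRPL π (all x A)           = all x (renameRPL π A)
  renameRPL π (ex x A)            = ex x (renameRPL π A)

  -- When a derivation is replayed, its eigenparameters and its type 1 variables may clash with the
  -- target hypersequent and are replaced by other ones. The `𝔮 i` stay fixed: no provable
  -- hypersequent of G¹ or G² contains one.
  record Renaming : Set where
    constructor ⟨_,_⟩
    field onParams on𝔭 : ℕ → ℕ

  renameFormula : Renaming → Formula → Formula
  renameFormula ⟨ π , σ ⟩ (rpl A) = rpl (renameRPL π A)
  renameFormula ⟨ π , σ ⟩ (𝔭 i)   = 𝔭 (σ i)
  renameFormula ⟨ π , σ ⟩ (𝔮 i)   = 𝔮 i

  rename : Renaming → Sequent → Sequent
  rename ρ (Γ ⇒ Δ) = map (renameFormula ρ) Γ ⇒ map (renameFormula ρ) Δ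

  mutual
    renameTerm-cong : ∀ {π π′} t → (∀ {a} → ParamInTerm a t → π a ≡ π′ a) →
                      renameTerm π t ≡ renameTerm π′ t
    renameTerm-cong (var x)    eq = refl
    renameTerm-cong (param a)  eq = cong param (eq param)
    renameTerm-cong (fun f ts) eq = cong (fun f) (renameTerms-cong ts (eq ∘ fun))

    renameTerms-cong : ∀ {π π′ n} (ts : Vec Term n) →
                       (∀ {a} → Vec.Any (ParamInTerm a) ts → π a ≡ π′ a) →
                       renameTerms π ts ≡ renameTerms π′ ts
    renameTerms-cong []       eq = refl
    renameTerms-cong (t ∷ ts) eq = cong₂ _∷_ (renameTerm-cong t (eq ∘ Vec.here))
                                             (renameTerms-cong ts (eq ∘ Vec.there))

  renameRPL-cong : ∀ {π π′} A → (∀ {a} → ParamIn a A → π a ≡ π′ a) → renameRPL π A ≡ renameRPL π′ A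
  renameRPL-cong (pred P ts)       eq = cong (pred P) (renameTerms-cong ts (eq ∘ pred))
  renameRPL-cong (const r 0≤r r≤1) eq = refl
  renameRPL-cong (A ⟶ B)           eq = cong₂ _⟶_ (renameRPL-cong A (eq ∘ ⟶ˡ)) (renameRPL-cong B (eq ∘ ⟶ʳ))
  renameRPL-cong (all x A)         eq = cong (all x) (renameRPL-cong A (eq ∘ all))
  renameRPL-cong (ex x A)          eq = cong (ex x) (renameRPL-cong A (eq ∘ ex))

  mutual
    renameTerm-id : ∀ t → renameTerm id t ≡ t
    renameTerm-id (var x)    = refl
    renameTerm-id (param a)  = refl
    renameTerm-id (fun f ts) = cong (fun f) (renameTerms-id ts)

    renameTerms-id : ∀ {n} (ts : Vec Term n) → renameTerms id ts ≡ ts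
    renameTerms-id []       = refl
    renameTerms-id (t ∷ ts) = cong₂ _∷_ (renameTerm-id t) (renameTerms-id ts)

  renameRPL-id : ∀ A → renameRPL id A ≡ A
  renameRPL-id (pred P ts)       = cong (pred P) (renameTerms-id ts)
  renameRPL-id (const r 0≤r r≤1) = refl
  renameRPL-id (A ⟶ B)           = cong₂ _⟶_ (renameRPL-id A) (renameRPL-id B)
  renameRPL-id (all x A)         = cong (all x) (renameRPL-id A)
  renameRPL-id (ex x A)          = cong (ex x) (renameRPL-id A)

  mutual
    renameTerm-subst : ∀ π x t s → renameTerm π (substTerm x t s) ≡ substTerm x (renameTerm π t) (renameTerm π s)
    renameTerm-subst π x t (var y) with x ℕₚ.≟ y
    ... | yes _ = refl
    ... | no  _ = refl
    renameTerm-subst π x t (param a)  = refl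
    renameTerm-subst π x t (fun f ts) = cong (fun f) (renameTerms-subst π x t ts)

    renameTerms-subst : ∀ π x t {n} (ss : Vec Term n) →
      renameTerms π (substTerms x t ss) ≡ substTerms x (renameTerm π t) (renameTerms π ss)
    renameTerms-subst π x t []       = refl
    renameTerms-subst π x t (s ∷ ss) = cong₂ _∷_ (renameTerm-subst π x t s) (renameTerms-subst π x t ss)

  renameRPL-subst : ∀ π A x t → renameRPL π (A [ x ≔ t ]) ≡ renameRPL π A [ x ≔ renameTerm π t ]
  renameRPL-subst π (pred P ts)       x t = cong (pred P) (renameTerms-subst π x t ts)
  renameRPL-subst π (const r 0≤r r≤1) x t = refl
  renameRPL-subst π (A ⟶ B)           x t = cong₂ _⟶_ (renameRPL-subst π A x t) (renameRPL-subst π B x t)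
  renameRPL-subst π (all y A)         x t with x ℕₚ.≟ y
  ... | yes _ = refl
  ... | no  _ = cong (all y) (renameRPL-subst π A x t)
  renameRPL-subst π (ex y A)          x t with x ℕₚ.≟ y
  ... | yes _ = refl
  ... | no  _ = cong (ex y) (renameRPL-subst π A x t)

  -- The hypothesis holds if a is fresh for A. An instance at the eigenparameter a of the source
  -- then becomes the instance at the parameter b of the target.
  renameRPL-instance : ∀ π a b x A → renameRPL (π [ a ↦ b ]) A ≡ renameRPL π A →
    renameRPL (π [ a ↦ b ]) (A [ x ≔ param a ]) ≡ renameRPL π A [ x ≔ param b ]
  renameRPL-instance π a b x A eq = ≡-trans (renameRPL-subst (π [ a ↦ b ]) A x (param a))
    (cong₂ (λ A k → A [ x ≔ param k ]) eq (↦-same π a b))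

  matrix-∀ : ∀ {x y A B} → Formula.rpl (all x A) ≡ rpl (all y B) → A ≡ B
  matrix-∀ refl = refl

  matrix-∃ : ∀ {x y A B} → Formula.rpl (ex x A) ≡ rpl (ex y B) → A ≡ B
  matrix-∃ refl = refl

  mutual
    renameTerm-closed : ∀ {π t} → Closed t → Closed (renameTerm π t)
    renameTerm-closed param    = param
    renameTerm-closed (fun cs) = fun (renameTerms-closed cs)

    renameTerms-closed : ∀ {π n} {ts : Vec Term n} → Vec.All Closed ts → Vec.All Closed (renameTerms π ts)
    renameTerms-closed Vec.[]       = Vec.[]
    renameTerms-closed (c Vec.∷ cs) = renameTerm-closed c Vec.∷ renameTerms-closed cs

  rename-fresh : ∀ {ρ ρ′} {P : Formula → Set} → (∀ F → ¬ P F → renameFormula ρ′ F ≡ renameFormula ρ F) →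
                 ∀ {H} → ¬ SomeMember P H → All (λ S → rename ρ′ S ≡ rename ρ S) H
  rename-fresh {ρ} {ρ′} {P} eq {[]}           fr = []
  rename-fresh {ρ} {ρ′} {P} eq {(Γ ⇒ Δ) ∷ H} fr =
    cong₂ _⇒_ (agree Γ (fr ∘ here ∘ inj₁)) (agree Δ (fr ∘ here ∘ inj₂)) ∷ rename-fresh eq (fr ∘ there)
    where
    agree : ∀ Γ → ¬ Any P Γ → map (renameFormula ρ′) Γ ≡ map (renameFormula ρ) Γ
    agree []      _  = refl
    agree (F ∷ Γ) fr = cong₂ _∷_ (eq F (fr ∘ here)) (agree Γ (fr ∘ there))

  rename-fresh-param : ∀ {π σ a b H} → a #ₐ H → All (λ S → rename ⟨ π [ a ↦ b ] , σ ⟩ S ≡ rename ⟨ π , σ ⟩ S) H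
  rename-fresh-param {π} {σ} {a} {b} = rename-fresh λ
    { (rpl A) a∉A → cong rpl (renameRPL-cong A λ {k} k∈A → ↦-other π a b λ { refl → a∉A (rpl k∈A) })
    ; (𝔭 i)   _   → refl
    ; (𝔮 i)   _   → refl }

  rename-fresh-𝔭 : ∀ {π σ i j H} → 𝔭 i # H → All (λ S → rename ⟨ π , σ [ i ↦ j ] ⟩ S ≡ rename ⟨ π , σ ⟩ S) H
  rename-fresh-𝔭 {π} {σ} {i} {j} = rename-fresh λ
    { (rpl A) _   → refl
    ; (𝔭 k)   i≢k → cong 𝔭 (↦-other σ i j λ { refl → i≢k refl })
    ; (𝔮 k)   _   → refl }

  -- Fresh parameters and variables

  mutual
    maxParamTerm : Term → ℕ
    maxParamTerm (var x)    = 0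
    maxParamTerm (param a)  = a
    maxParamTerm (fun f ts) = maxParamTerms ts

    maxParamTerms : ∀ {n} → Vec Term n → ℕ
    maxParamTerms []       = 0
    maxParamTerms (t ∷ ts) = maxParamTerm t ⊔ maxParamTerms ts

  maxParamRPL : RPL → ℕ
  maxParamRPL (pred P ts)       = maxParamTerms ts
  maxParamRPL (const r 0≤r r≤1) = 0
  maxParamRPL (A ⟶ B)           = maxParamRPL A ⊔ maxParamRPL B
  maxParamRPL (all x A)         = maxParamRPL A
  maxParamRPL (ex x A)          = maxParamRPL A

  maxParam : Formula → ℕ
  maxParam (rpl A) = maxParamRPL A
  maxParam (𝔭 i)   = 0
  maxParam (𝔮 i)   = 0

  mutual
    ParamInTerm⇒≤ : ∀ {a t} → ParamInTerm a t → a ℕ.≤ maxParamTerm t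
    ParamInTerm⇒≤ param   = ℕₚ.≤-refl
    ParamInTerm⇒≤ (fun p) = ParamInTerms⇒≤ p

    ParamInTerms⇒≤ : ∀ {a n} {ts : Vec Term n} → Vec.Any (ParamInTerm a) ts → a ℕ.≤ maxParamTerms ts
    ParamInTerms⇒≤ {ts = t ∷ ts} (Vec.here p)  = ℕₚ.≤-trans (ParamInTerm⇒≤ p) (ℕₚ.m≤m⊔n _ _)
    ParamInTerms⇒≤ {ts = t ∷ ts} (Vec.there p) = ℕₚ.≤-trans (ParamInTerms⇒≤ p) (ℕₚ.m≤n⊔m (maxParamTerm t) _)

  ParamIn⇒≤ : ∀ {a A} → ParamIn a A → a ℕ.≤ maxParamRPL A
  ParamIn⇒≤ (pred p)           = ParamInTerms⇒≤ p
  ParamIn⇒≤ (⟶ˡ p)             = ℕₚ.≤-trans (ParamIn⇒≤ p) (ℕₚ.m≤m⊔n _ _)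
  ParamIn⇒≤ {A = A ⟶ B} (⟶ʳ p) = ℕₚ.≤-trans (ParamIn⇒≤ p) (ℕₚ.m≤n⊔m (maxParamRPL A) _)
  ParamIn⇒≤ (all p)            = ParamIn⇒≤ p
  ParamIn⇒≤ (ex p)             = ParamIn⇒≤ p

  index : Formula → ℕ
  index (rpl A) = 0
  index (𝔭 i)   = i
  index (𝔮 i)   = i

  maxOver : (Formula → ℕ) → Hypersequent → ℕ
  maxOver f = max λ S → max f (antecedent S) ⊔ max f (succedent S)

  fresh : ∀ {P : ℕ → Formula → Set} {f} → (∀ {n F} → P n F → n ℕ.≤ f F) →
          ∀ H → ¬ SomeMember (P (suc (maxOver f H))) H
  fresh {f = f} b H p = ℕₚ.<-irrefl refl (max-bound
    (λ { {Γ ⇒ Δ} (inj₁ q) → ℕₚ.≤-trans (max-bound b q) (ℕₚ.m≤m⊔n (max f Γ) (max f Δ))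
       ; {Γ ⇒ Δ} (inj₂ q) → ℕₚ.≤-trans (max-bound b q) (ℕₚ.m≤n⊔m (max f Γ) (max f Δ)) }) p)

  fresh-param : ∀ H → ∃[ a ] a #ₐ H
  fresh-param H = _ , fresh {P = ParamInFormula} {f = maxParam} (λ { (rpl p) → ParamIn⇒≤ p }) H

  fresh-𝔭 : ∀ H → ∃[ i ] 𝔭 i # H
  fresh-𝔭 H = _ , fresh {P = λ i F → 𝔭 i ≡ F} {f = index} (λ { refl → ℕₚ.≤-refl }) H

  fresh-𝔮 : ∀ H → ∃[ i ] 𝔮 i # H
  fresh-𝔮 H = _ , fresh {P = λ i F → 𝔮 i ≡ F} {f = index} (λ { refl → ℕₚ.≤-refl }) H

  -- Sequents up to permutation

  infix 4 _∼_

  _∼_ : Sequent → Sequent → Set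
  S ∼ T = (antecedent S ↭ antecedent T) × (succedent S ↭ succedent T)

  ∼-refl : ∀ {S} → S ∼ S
  ∼-refl = ↭-refl , ↭-refl

  ∼-sym : ∀ {S T} → S ∼ T → T ∼ S
  ∼-sym (p , q) = ↭-sym p , ↭-sym q

  ∼-trans : ∀ {S T U} → S ∼ T → T ∼ U → S ∼ U
  ∼-trans (p , q) (p′ , q′) = ↭-trans p p′ , ↭-trans q q′

  rename-∼ : ∀ ρ {S T} → S ∼ T → rename ρ S ∼ rename ρ T
  rename-∼ ρ (p , q) = ↭ₚ.map⁺ _ p , ↭ₚ.map⁺ _ q

  ≋-refl : ∀ {H} → H ≋ H
  ≋-refl = refl (Pointwise.refl ∼-refl)

  ≋-sym : ∀ {H K} → H ≋ K → K ≋ H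
  ≋-sym = Perm.sym ∼-sym

  infixr 6 _⊕_

  _⊕_ : Sequent → Sequent → Sequent
  S ⊕ T = antecedent S ++ antecedent T ⇒ succedent S ++ succedent T

  ⊕-cong : ∀ {S T S′ T′} → S ∼ T → S′ ∼ T′ → S ⊕ S′ ∼ T ⊕ T′
  ⊕-cong (p , q) (p′ , q′) = ↭ₚ.++⁺ p p′ , ↭ₚ.++⁺ q q′

  ⊕-commutativeMonoid : CommutativeMonoid 0ℓ 0ℓ
  ⊕-commutativeMonoid = record
    { Carrier = Sequent ; _≈_ = _∼_ ; _∙_ = _⊕_ ; ε = [] ⇒ []
    ; isCommutativeMonoid = record
      { isMonoid = record
        { isSemigroup = record
          { isMagma = record
            { isEquivalence = record { refl = ∼-refl ; sym = ∼-sym ; trans = ∼-trans }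
            ; ∙-cong        = ⊕-cong }
          ; assoc = λ S T U → ↭ₚ.++-assoc (antecedent S) _ _ , ↭ₚ.++-assoc (succedent S) _ _ }
        ; identity = (λ S → ∼-refl) , λ S → ↭ₚ.++-identityʳ _ , ↭ₚ.++-identityʳ _ }
      ; comm = λ S T → ↭ₚ.++-comm (antecedent S) _ , ↭ₚ.++-comm (succedent S) _ } }

  open CommutativeMonoid ⊕-commutativeMonoid public using () renaming (assoc to ⊕-assoc; comm to ⊕-comm)

  ⊕-swap : ∀ S T U → S ⊕ T ⊕ U ∼ T ⊕ S ⊕ U
  ⊕-swap = solve 3 (λ a b c → a :⊕ (b :⊕ c) ⊜ b :⊕ (a :⊕ c)) ∼-refl
    where open Algebra.Solver.CommutativeMonoid ⊕-commutativeMonoid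
            using (solve; _⊜_) renaming (_⊕_ to _:⊕_)

  -- Decompositions, coverings and permutation of rules

  data Side : Set where
    lhs rhs : Side

  -- A principal formula as a sequent of its own: a conclusion has the form `at s F ⊕ C`, so that
  -- left and right rules are treated alike.
  at : Side → Formula → Sequent
  at lhs F = [ F ] ⇒ []
  at rhs F = [] ⇒ [ F ]

  at-split : ∀ s {F C} X {Y} → at s F ⊕ C ∼ X ⊕ Y →
    (∃[ X′ ] X ∼ at s F ⊕ X′ × C ∼ X′ ⊕ Y) ⊎ (∃[ Y′ ] Y ∼ at s F ⊕ Y′ × C ∼ X ⊕ Y′)
  at-split lhs (Γ ⇒ Δ) {Γ′ ⇒ Δ′} (p , q) with ∷↭++⁻ Γ p
  ... | inj₁ (Γ₁ , p₁ , p₂) = inj₁ ((Γ₁ ⇒ Δ) , (p₁ , ↭-refl) , (p₂ , q))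
  ... | inj₂ (Γ₁ , p₁ , p₂) = inj₂ ((Γ₁ ⇒ Δ′) , (p₁ , ↭-refl) , (p₂ , q))
  at-split rhs (Γ ⇒ Δ) {Γ′ ⇒ Δ′} (p , q) with ∷↭++⁻ Δ q
  ... | inj₁ (Δ₁ , q₁ , q₂) = inj₁ ((Γ ⇒ Δ₁) , (↭-refl , q₁) , (p , q₂))
  ... | inj₂ (Δ₁ , q₁ , q₂) = inj₂ ((Γ′ ⇒ Δ₁) , (↭-refl , q₁) , (p , q₂))

  at-∼⁻ : ∀ s s′ {F F′ X} → at s′ F′ ∼ at s F ⊕ X → s ≡ s′ × F ≡ F′ × X ≡ ([] ⇒ [])
  at-∼⁻ lhs lhs (p , q) with ↭ₚ.↭-singleton-inv (↭-sym p) | ↭ₚ.↭-empty-inv (↭-sym q)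
  ... | refl | refl = refl , refl , refl
  at-∼⁻ rhs rhs (p , q) with ↭ₚ.↭-empty-inv (↭-sym p) | ↭ₚ.↭-singleton-inv (↭-sym q)
  ... | refl | refl = refl , refl , refl
  at-∼⁻ lhs rhs (p , q) with ↭ₚ.↭-empty-inv (↭-sym p)
  ... | ()
  at-∼⁻ rhs lhs (p , q) with ↭ₚ.↭-empty-inv (↭-sym q)
  ... | ()

  -- In `Expand s A D E`, a backward step replaces A on side s of its sequent by D and adds the
  -- sequents E. (∀⇒) and (⇒∃) are absent: G² retains their principal sequents, and G³ cuts them,
  -- which `split` records.
  data Expand : Side → RPL → Sequent → List Sequent → Set where
    ⟶ˡ  : ∀ {A B} i → Expand lhs (A ⟶ B) (at lhs (𝔭 i)) [ [ rpl B ] ⇒ 𝔭 i ∷ rpl A ∷ [] ]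
    ⟶ʳ₁ : ∀ {A B} → Expand rhs (A ⟶ B) ([] ⇒ []) []
    ⟶ʳ₂ : ∀ {A B} → Expand rhs (A ⟶ B) ([ rpl A ] ⇒ [ rpl B ]) []
    ∀ʳ  : ∀ {x A} a → Expand rhs (all x A) (at rhs (rpl (A [ x ≔ param a ]))) []
    ∃ˡ  : ∀ {x A} a → Expand lhs (ex x A) (at lhs (rpl (A [ x ≔ param a ]))) []

  data Semipropositional : Formula → Set where
    𝔭 : ∀ {i} → Semipropositional (𝔭 i)
    𝔮 : ∀ {i} → Semipropositional (𝔮 i)

  -- A branching rule is represented by either of its premises, since a branch of
  -- a backward proof search sees only one of them; (∀⇒)³ and (⇒∃)³ cut a sequent
  -- at a semipropositional variable, which accounts for split.
  data Cov (K : Hypersequent) : Sequent → Set where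
    member : ∀ {S} → Any (S ∼_) K → Cov K S
    expand : ∀ {S s A D E C} → Expand s A D E → S ∼ at s (rpl A) ⊕ C →
             Cov K (D ⊕ C) → All (Cov K) E → Cov K S
    split  : ∀ {S F X Y} → Semipropositional F → S ∼ X ⊕ Y →
             Cov K (at rhs F ⊕ X) → Cov K (at lhs F ⊕ Y) → Cov K S

  infix 4 _≽_

  _≽_ : Hypersequent → Hypersequent → Set
  K′ ≽ K = All (Cov K′) K

  Cov-resp-∼ : ∀ {K S T} → S ∼ T → Cov K S → Cov K T
  Cov-resp-∼ e (member m)        = member (Any.map (∼-trans (∼-sym e)) m)
  Cov-resp-∼ e (expand x e′ c d) = expand x (∼-trans (∼-sym e) e′) c d
  Cov-resp-∼ e (split f e′ c d)  = split f (∼-trans (∼-sym e) e′) c d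

  mutual
    -- Makes coverings compose: each member of K at the leaves of the covering is replaced by its
    -- own covering by `K′`.
    Cov-mono : ∀ {K K′ S} → K′ ≽ K → Cov K S → Cov K′ S
    Cov-mono g (member m) = All.lookupWith (λ c e → Cov-resp-∼ (∼-sym e) c) g m
    Cov-mono g (expand x e c d) = expand x e (Cov-mono g c) (Cov-mono-All g d)
    Cov-mono g (split f e c d)  = split f e (Cov-mono g c) (Cov-mono g d)

    Cov-mono-All : ∀ {K K′ L} → K′ ≽ K → All (Cov K) L → All (Cov K′) L
    Cov-mono-All g []       = []
    Cov-mono-All g (c ∷ cs) = Cov-mono g c ∷ Cov-mono-All g cs

  ≽-++ : ∀ L K → L ++ K ≽ K
  ≽-++ L K = All.tabulate λ m → member (skip L (Any.map (λ { refl → ∼-refl }) m))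
    where
    skip : ∀ L {S} → Any (S ∼_) K → Any (S ∼_) (L ++ K)
    skip []      m = m
    skip (_ ∷ L) m = there (skip L m)

  ≽-≋ : ∀ {L K K′} → K ≋ K′ → L ≽ K → L ≽ K′
  ≽-≋ = Permutation-All Cov-resp-∼

  to-front : ∀ {S K} → Any (S ∼_) K → ∃[ G ] S ∷ G ≋ K
  to-front (here e)              = _ , prep e ≋-refl
  to-front {K = T ∷ K} (there m) with to-front m
  ... | G , p = T ∷ G , trans (swap ∼-refl ∼-refl ≋-refl) (prep ∼-refl p)

  -- A rule acting on A in the context C may be applied to all hypersequents
  -- that cover A in C once it may be applied to those that contain it, because
  -- it permutes with the decomposition of other formulas.
  permute : ∀ {T : Hypersequent → Set₁} s A (P : Sequent → List Sequent → Set) →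
    (∀ {D E} → Expand s A D E → P D E) →
    (∀ {K C} → Any (at s (rpl A) ⊕ C ∼_) K →
       (∀ {K′ D E} → K′ ≽ K → P D E → Cov K′ (D ⊕ C) → All (Cov K′) E → T K′) → T K) →
    ∀ {K S C} → Cov K S → S ∼ at s (rpl A) ⊕ C →
    (∀ {K′ D E} → K′ ≽ K → P D E → Cov K′ (D ⊕ C) → All (Cov K′) E → T K′) → T K
  permute s A P e⇒P base (member m) eq k = base (Any.map (∼-trans (∼-sym eq)) m) k
  permute s A P e⇒P base {C = C} (expand {s = s′} {A′} {D′} {C = C′} x e c d) eq k
    with at-split s (at s′ (rpl A′)) (∼-trans (∼-sym eq) e)
  ... | inj₁ (X′ , p , q) with at-∼⁻ s s′ p
  -- The formula in question is the one decomposed here. The recorded decomposition supplies the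
  -- premise, and no rule is applied.
  ...   | refl , refl , refl = k (≽-++ [] _) (e⇒P x) (Cov-resp-∼ (⊕-cong ∼-refl (∼-sym q)) c) d
  -- A different formula was decomposed. A is treated inside the result, and the outer decomposition
  -- is then put back around it.
  permute s A P e⇒P base {C = C} (expand {s = s′} {A′} {D′} {C = C′} x e c d) eq k
      | inj₂ (Y′ , p , q) = permute s A P e⇒P base c
    (∼-trans (⊕-cong ∼-refl p) (⊕-swap D′ (at s (rpl A)) Y′))
    λ {K′} {D} g pDE cD cE → k g pDE
      (expand x (∼-trans (⊕-cong ∼-refl q) (⊕-swap D (at s′ (rpl A′)) Y′))
        (Cov-resp-∼ (⊕-swap D D′ Y′) cD) (Cov-mono-All g d)) cE
  -- A lies in exactly one of the two parts of the cut; only that part changes, and the other is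
  -- transported to `K′`.
  permute s A P e⇒P base (split {F = F} {X} {Y} f e c d) eq k
    with at-split s X (∼-trans (∼-sym eq) e)
  ... | inj₁ (X′ , p , q) = permute s A P e⇒P base c
    (∼-trans (⊕-cong ∼-refl p) (⊕-swap (at rhs F) (at s (rpl A)) X′))
    λ {K′} {D} g pDE cD cE → k g pDE
      (split f (∼-trans (⊕-cong ∼-refl q) (∼-sym (⊕-assoc D X′ Y)))
        (Cov-resp-∼ (⊕-swap D (at rhs F) X′) cD) (Cov-mono g d)) cE
  ... | inj₂ (Y′ , p , q) = permute s A P e⇒P base d
    (∼-trans (⊕-cong ∼-refl p) (⊕-swap (at lhs F) (at s (rpl A)) Y′))
    λ {K′} {D} g pDE cD cE → k g pDE
      (split f (∼-trans (⊕-cong ∼-refl q) (⊕-swap D X Y′))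
        (Cov-mono g c) (Cov-resp-∼ (⊕-swap D (at lhs F) Y′) cD)) cE

  Covers : Hypersequent → Renaming → Hypersequent → Set
  Covers K ρ H = All (λ S → Cov K (rename ρ S)) H

  Without𝔮 : Formula → Set
  Without𝔮 (rpl A) = ⊤
  Without𝔮 (𝔭 i)   = ⊤
  Without𝔮 (𝔮 i)   = ⊥

  Without𝔮ˢ : Sequent → Set
  Without𝔮ˢ S = All Without𝔮 (antecedent S) × All Without𝔮 (succedent S)

  Without𝔮⇒# : ∀ {H} → All Without𝔮ˢ H → ∀ i → 𝔮 i # H
  Without𝔮⇒# ws i m = All.lookupWith (λ { (γ , δ) → [ absurd γ , absurd δ ]′ }) ws m
    where
    absurd : ∀ {Γ} → All Without𝔮 Γ → ¬ Any (𝔮 i ≡_) Γ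
    absurd = All.lookupWith λ { () refl }

  Without𝔮-≋ : ∀ {H H′} → H ≋ H′ → All Without𝔮ˢ H → All Without𝔮ˢ H′
  Without𝔮-≋ = Permutation-All resp
    where
    resp : ∀ {S T} → S ∼ T → Without𝔮ˢ S → Without𝔮ˢ T
    resp (p , q) (γ , δ) = ↭ₚ.All-resp-↭ p γ , ↭ₚ.All-resp-↭ q δ

-- Truth of sequents and preservation of axioms

module Semantics (Sg : Signature) where
  open Signature Sg
  open Calculi Sg
  open Syntax Sg
  open ℝ-Solver using (solve; _⊜_) renaming (_⊕_ to _:⊹_)

  Atomic : Sequent → Set
  Atomic S = All Atom (antecedent S) × All Atom (succedent S)

  module Values (M : HSInterpretation) (ν : ℕ → HSInterpretation.Dom M) where
    open HSInterpretation M

    -- The value minus 1; quantified formulas get the junk value 0.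
    value₋₁ : RPL → ℝ
    value₋₁ (pred P ts)   = predᴵ P (⟦_⟧ᵗˢ M ν ts) ⊟ 1ℝ
    value₋₁ (const r _ _) = fromℚ r ⊟ 1ℝ
    value₋₁ (A ⟶ B)       = 0ℝ ⊓ (value₋₁ B ⊟ value₋₁ A)
    value₋₁ (all x A)     = 0ℝ ⊟ 1ℝ
    value₋₁ (ex x A)      = 0ℝ ⊟ 1ℝ

    -- The values of the semipropositional variables are kept apart from M, because they are later
    -- updated one at a time while M stays the same.
    module Assignment (P Q : ℕ → ℝ) where
      formula₋₁ : Formula → ℝ
      formula₋₁ (rpl A) = value₋₁ A
      formula₋₁ (𝔭 i)   = P i ⊟ 1ℝ
      formula₋₁ (𝔮 i)   = Q i ⊟ 1ℝ

      sum : List Formula → ℝ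
      sum []      = 0ℝ
      sum (F ∷ Γ) = formula₋₁ F ⊹ sum Γ

      True : Sequent → Set
      True S = sum (antecedent S) ⊑ sum (succedent S)

      sum-++ : ∀ Γ Δ → sum (Γ ++ Δ) ≃ sum Γ ⊹ sum Δ
      sum-++ []      Δ = ≃-sym (⊹-identityˡ (sum Δ))
      sum-++ (F ∷ Γ) Δ = ≃-trans (⊹-cong ≃-refl (sum-++ Γ Δ)) (≃-sym (⊹-assoc (formula₋₁ F) (sum Γ) (sum Δ)))

      sum-↭ : ∀ {Γ Δ} → Γ ↭ Δ → sum Γ ≃ sum Δ
      sum-↭ ↭.refl         = ≃-refl
      sum-↭ (↭.prep F p)   = ⊹-cong ≃-refl (sum-↭ p)
      sum-↭ (↭.swap F G p) = ≃-trans (⊹-cong ≃-refl (⊹-cong ≃-refl (sum-↭ p)))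
        (solve 3 (λ a b c → a :⊹ (b :⊹ c) ⊜ b :⊹ (a :⊹ c)) ≃-refl (formula₋₁ F) (formula₋₁ G) _)
      sum-↭ (↭.trans p q)  = ≃-trans (sum-↭ p) (sum-↭ q)

      True-resp-∼ : ∀ {S T} → S ∼ T → True S → True T
      True-resp-∼ (p , q) t = ⊑-trans (proj₂ (sum-↭ p)) (⊑-trans t (proj₁ (sum-↭ q)))

      -- Falsity of the part with F on the right bounds F plus the succedent of X by the antecedent
      -- of X. Adding this to the inequality for `X ⊕ Y` cancels X.
      True-split : ∀ F X Y → True (X ⊕ Y) → ¬ True (at rhs F ⊕ X) → True (at lhs F ⊕ Y)
      True-split F (Γ ⇒ Δ) (Γ′ ⇒ Δ′) t f = combine (sum Γ ⊹ sum Δ)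
        (⊑-trans (proj₂ (sum-++ Γ Γ′)) (⊑-trans t (proj₁ (sum-++ Δ Δ′)))) (⋢⇒⊒ f)
        (solve 4 (λ f γ δ γ′ → (f :⊹ γ′) :⊹ (γ :⊹ δ) ⊜ (γ :⊹ γ′) :⊹ (f :⊹ δ)) ≃-refl (formula₋₁ F) (sum Γ) (sum Δ) (sum Γ′))
        (solve 3 (λ γ δ δ′ → (δ :⊹ δ′) :⊹ γ ⊜ δ′ :⊹ (γ :⊹ δ)) ≃-refl (sum Γ) (sum Δ) (sum Δ′))

    open Assignment 𝔭ᴵ 𝔮ᴵ using (True; formula₋₁) renaming (sum to sumᴹ)

    atom-≡ : ∀ {F} (a : Atom F) → ⟦_⟧ M ν a ⊟ 1ℝ ≡ formula₋₁ F
    atom-≡ pred  = refl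
    atom-≡ const = refl
    atom-≡ 𝔭     = refl
    atom-≡ 𝔮     = refl

    sum-≡ : ∀ {Γ} (γ : All Atom Γ) → ⟦_⟧ᵐ M ν γ ≡ sumᴹ Γ
    sum-≡ []      = refl
    sum-≡ (a ∷ γ) = +-≡ {⟦_⟧ M ν a - 1ℝ} {⟦_⟧ᵐ M ν γ} (≡-trans (⊟-def (⟦_⟧ M ν a) 1ℝ) (atom-≡ a)) (sum-≡ γ)

    True⇒AtomicAndTrue : ∀ {S} → Atomic S → True S → AtomicAndTrue M ν S
    True⇒AtomicAndTrue {Γ ⇒ Δ} (γ , δ) t = γ , δ ,
      ⊑⇒≤ (subst (0ℝ ⊑_) (sym (minus-≡ {⟦_⟧ᵐ M ν δ} {⟦_⟧ᵐ M ν γ} (sum-≡ δ) (sum-≡ γ))) (⊑⇒0⊑⊟ t))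

    -- An atomic sequent has no compound formula to decompose, so only cuts lie between it and
    -- members of K, and `True-split` follows truth through these.
    Cov-True : ∀ {K S} → Cov K S → Atomic S → True S → ¬ ¬ Any (AtomicAndTrue M ν) K
    Cov-True (member m) (γ , δ) t ¬any = ¬any (Any.map (λ { e@(p , q) → True⇒AtomicAndTrue
      (↭ₚ.All-resp-↭ p γ , ↭ₚ.All-resp-↭ q δ) (Assignment.True-resp-∼ 𝔭ᴵ 𝔮ᴵ e t) }) m)
    Cov-True (expand (⟶ˡ i) (p , q) _ _) (γ , δ) with ↭ₚ.All-resp-↭ p γ
    ... | () ∷ _
    Cov-True (expand ⟶ʳ₁ (p , q) _ _) (γ , δ) with ↭ₚ.All-resp-↭ q δ
    ... | () ∷ _
    Cov-True (expand ⟶ʳ₂ (p , q) _ _) (γ , δ) with ↭ₚ.All-resp-↭ q δ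
    ... | () ∷ _
    Cov-True (expand (∀ʳ a) (p , q) _ _) (γ , δ) with ↭ₚ.All-resp-↭ q δ
    ... | () ∷ _
    Cov-True (expand (∃ˡ a) (p , q) _ _) (γ , δ) with ↭ₚ.All-resp-↭ p γ
    ... | () ∷ _
    Cov-True (split {F = F} {X} {Y} f e@(p , q) c d) (γ , δ) t ¬any =
      Cov-True d (atom f ∷ proj₂ γs , proj₂ δs)
        (True-split F X Y (True-resp-∼ e t)
          λ t′ → Cov-True c (proj₁ γs , atom f ∷ proj₁ δs) t′ ¬any)
        ¬any
      where
      open Assignment 𝔭ᴵ 𝔮ᴵ using (True-split; True-resp-∼)
      γs = Allₚ.++⁻ (antecedent X) (↭ₚ.All-resp-↭ p γ)
      δs = Allₚ.++⁻ (succedent X) (↭ₚ.All-resp-↭ q δ)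
      atom : ∀ {F} → Semipropositional F → Atom F
      atom 𝔭 = 𝔭
      atom 𝔮 = 𝔮

  module Reinterpret (M : HSInterpretation) (ν : ℕ → HSInterpretation.Dom M)
    (P Q : ℕ → ℝ) (P≤1 : ∀ i → P i ≤ 1ℝ) (Q≥0 : ∀ i → 0ℝ ≤ Q i) (ρ : Renaming) where
    open HSInterpretation M hiding (𝔭ᴵ; 𝔮ᴵ)
    open Renaming ρ renaming (onParams to π; on𝔭 to σ)
    open Values M ν using (value₋₁)
    open Values.Assignment M ν P Q

    -- M pulled back along the renaming: a sequent has the same value here as its renaming has in M
    -- under P and Q. An axiom can thereby be used at its renaming.
    M′ : HSInterpretation
    M′ = record
      { Dom = Dom ; nonempty = nonempty ; funᴵ = funᴵ ; paramᴵ = paramᴵ ∘ π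
      ; predᴵ = predᴵ ; predᴵ≥0 = predᴵ≥0 ; predᴵ≤1 = predᴵ≤1
      ; 𝔮ᴵ = Q ; 𝔮ᴵ≥0 = Q≥0 ; 𝔭ᴵ = P ∘ σ ; 𝔭ᴵ≤1 = P≤1 ∘ σ }

    mutual
      term-≡ : ∀ t → ⟦_⟧ᵗ M′ ν t ≡ ⟦_⟧ᵗ M ν (renameTerm π t)
      term-≡ (var x)    = refl
      term-≡ (param a)  = refl
      term-≡ (fun f ts) = cong (funᴵ f) (terms-≡ ts)

      terms-≡ : ∀ {n} (ts : Vec Term n) → ⟦_⟧ᵗˢ M′ ν ts ≡ ⟦_⟧ᵗˢ M ν (renameTerms π ts)
      terms-≡ []       = refl
      terms-≡ (t ∷ ts) = cong₂ _∷_ (term-≡ t) (terms-≡ ts)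

    atom-rename : ∀ {F} (a : Atom F) → ⟦_⟧ M′ ν a ⊟ 1ℝ ≡ formula₋₁ (renameFormula ρ F)
    atom-rename (pred {P = R} {ts}) = cong (λ ds → predᴵ R ds ⊟ 1ℝ) (terms-≡ ts)
    atom-rename const               = refl
    atom-rename 𝔭                   = refl
    atom-rename 𝔮                   = refl

    sum-rename : ∀ {Γ} (γ : All Atom Γ) → ⟦_⟧ᵐ M′ ν γ ≡ sum (map (renameFormula ρ) Γ)
    sum-rename []      = refl
    sum-rename (a ∷ γ) = +-≡ {⟦_⟧ M′ ν a - 1ℝ} {⟦_⟧ᵐ M′ ν γ} (≡-trans (⊟-def (⟦_⟧ M′ ν a) 1ℝ) (atom-rename a)) (sum-rename γ)

    AtomicAndTrue⇒True : ∀ {S} → AtomicAndTrue M′ ν S → Atomic S × True (rename ρ S)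
    AtomicAndTrue⇒True {Γ ⇒ Δ} (γ , δ , p) = (γ , δ) ,
      0⊑⊟⇒⊑ (subst (0ℝ ⊑_) (minus-≡ {⟦_⟧ᵐ M′ ν δ} {⟦_⟧ᵐ M′ ν γ} (sum-rename δ) (sum-rename γ)) (≤⇒⊑ p))

    Axiom⇒True : ∀ {H} → Axiom H → ¬ ¬ Any (λ S → Atomic S × True (rename ρ S)) H
    Axiom⇒True ax ¬any = ax M′ ν λ any → ¬any (Any.map AtomicAndTrue⇒True any)

  rename-Atomic : ∀ {ρ S} → Atomic S → Atomic (rename ρ S)
  rename-Atomic (γ , δ) = Allₚ.map⁺ (All.map atom γ) , Allₚ.map⁺ (All.map atom δ)
    where
    atom : ∀ {ρ F} → Atom F → Atom (renameFormula ρ F)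
    atom pred  = pred
    atom const = const
    atom 𝔭     = 𝔭
    atom 𝔮     = 𝔮

  Axiom-Cov : ∀ {H ρ K} → Covers K ρ H → Axiom H → Axiom K
  Axiom-Cov {ρ = ρ} cs ax M ν ¬any = Axiom⇒True ax λ any →
    let c , (atomic , t) = All.lookupAny cs any
    in Values.Cov-True M ν c (rename-Atomic atomic) t ¬any
    where
    open HSInterpretation M
    open Reinterpret M ν 𝔭ᴵ 𝔮ᴵ 𝔭ᴵ≤1 𝔮ᴵ≥0 ρ

-- From G¹ to G² and from G² to G³

module Translation (Sg : Signature) where
  open Signature Sg
  open Calculi Sg
  open Syntax Sg
  open Semantics Sg using (Axiom-Cov)

  -- What replaying requires of the target calculus. The rules (∀⇒) and (⇒∃) ask only for some K
  -- covering the conclusion and the instance, a form that suits both the retained sequent of G² and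
  -- the cuts of G³.
  record Target (T : Hypersequent → Set₁) : Set₁ where
    field
      exchangeᵀ : ∀ {H H′} → H ≋ H′ → T H → T H′
      axiomᵀ    : ∀ {H} → Axiom H → T H

      ⟶⇒ᵀ : ∀ {G Γ Δ A B} i →
        let H = (rpl (A ⟶ B) ∷ Γ ⇒ Δ) ∷ G in 𝔭 i # H →
        T ((𝔭 i ∷ Γ ⇒ Δ) ∷ (rpl B ∷ [] ⇒ 𝔭 i ∷ rpl A ∷ []) ∷ G) →
        T H

      ⇒⟶ᵀ : ∀ {G Γ Δ A B} →
        T ((Γ ⇒ Δ) ∷ G) →
        T ((rpl A ∷ Γ ⇒ rpl B ∷ Δ) ∷ G) →
        T ((Γ ⇒ rpl (A ⟶ B) ∷ Δ) ∷ G)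

      ∀⇒ᵀ : ∀ {G Γ Δ x A} t → Closed t →
        let H = (rpl (all x A) ∷ Γ ⇒ Δ) ∷ G in
        (∀ {K} → K ≽ H → Cov K (rpl (A [ x ≔ t ]) ∷ Γ ⇒ Δ) → T K) →
        T H

      ⇒∀ᵀ : ∀ {G Γ Δ x A} a →
        let H = (Γ ⇒ rpl (all x A) ∷ Δ) ∷ G in a #ₐ H →
        T ((Γ ⇒ rpl (A [ x ≔ param a ]) ∷ Δ) ∷ G) →
        T H

      ⇒∃ᵀ : ∀ {G Γ Δ x A} t → Closed t →
        let H = (Γ ⇒ rpl (ex x A) ∷ Δ) ∷ G in
        (∀ {K} → K ≽ H → Cov K (Γ ⇒ rpl (A [ x ≔ t ]) ∷ Δ) → T K) →
        T H

      ∃⇒ᵀ : ∀ {G Γ Δ x A} a →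
        let H = (rpl (ex x A) ∷ Γ ⇒ Δ) ∷ G in a #ₐ H →
        T ((rpl (A [ x ≔ param a ]) ∷ Γ ⇒ Δ) ∷ G) →
        T H

  first : ∀ {S K} → Cov (S ∷ K) S
  first = member (here ∼-refl)

  module _ {T : Hypersequent → Set₁} (target : Target T) where
    private module T = Target target

    Continue : Hypersequent → Sequent → (Sequent → List Sequent → Set) → Set₁
    Continue K C P = ∀ {K′ D E} → K′ ≽ K → P D E → Cov K′ (D ⊕ C) → All (Cov K′) E → T K′

    apply : ∀ {s A P} → (∀ {D E} → Expand s A D E → P D E) →
      (∀ {C G} → Continue ((at s (rpl A) ⊕ C) ∷ G) C P → T ((at s (rpl A) ⊕ C) ∷ G)) →
      ∀ {K C} → Cov K (at s (rpl A) ⊕ C) → Continue K C P → T K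
    apply {s} {A} {P} e⇒P rule c = permute s A P e⇒P
      (λ m k → let G , p = to-front m in
        T.exchangeᵀ p (rule λ g → k (≽-≋ p g)))
      c ∼-refl

    apply-expand : ∀ {s A} →
      (∀ {C G} → Continue ((at s (rpl A) ⊕ C) ∷ G) C (Expand s A) → T ((at s (rpl A) ⊕ C) ∷ G)) →
      ∀ {K C} → Cov K (at s (rpl A) ⊕ C) → Continue K C (Expand s A) → T K
    apply-expand = apply id

    Covers-≡ : ∀ {K ρ ρ′ H} → All (λ S → rename ρ′ S ≡ rename ρ S) H → Covers K ρ H → Covers K ρ′ H
    Covers-≡ es cs = All.zipWith (λ (e , c) → subst (Cov _) (sym e) c) (es , cs)

    Covers-mono : ∀ {K K′ ρ H} → K′ ≽ K → Covers K ρ H → Covers K′ ρ H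
    Covers-mono g = All.map (Cov-mono g)

    module _ {ρ : Renaming} {K : Hypersequent} where
      open Renaming ρ renaming (onParams to π; on𝔭 to σ)

      -- As in the other simulations, the continuation receives coverings of the premise together
      -- with all of H, as G¹ needs; for G² the covering of the principal sequent is dropped.
      sim-⟶⇒ : ∀ {G Γ Δ A B i} →
        let H = (rpl (A ⟶ B) ∷ Γ ⇒ Δ) ∷ G in 𝔭 i # H → Covers K ρ H →
        (∀ {ρ′ K′} → Covers K′ ρ′ ((𝔭 i ∷ Γ ⇒ Δ) ∷ (rpl B ∷ [] ⇒ 𝔭 i ∷ rpl A ∷ []) ∷ H) → T K′) → T K
      sim-⟶⇒ {G} {Γ} {Δ} {A} {B} {i} i#H cs@(c ∷ _) k = apply-expand
        (λ {C} {G} k → let j , j# = fresh-𝔭 (((at lhs (rpl (_ ⟶ _))) ⊕ C) ∷ G) in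
          T.⟶⇒ᵀ j j# (k (expand (⟶ˡ j) ∼-refl first (member (there (here ∼-refl)) ∷ []) ∷ ≽-++ (_ ∷ _ ∷ []) G)
            (⟶ˡ j) first (member (there (here ∼-refl)) ∷ [])))
        c
        -- The variable j may be newly chosen or stem from an earlier decomposition in K. Sending i
        -- to j does not affect the renaming of H, since i is fresh for H.
        λ { {K′} g (⟶ˡ j) cD (cE ∷ []) → let new = rename-fresh-𝔭 {π} {σ} {i} {j} i#H in
          k {⟨ π , σ [ i ↦ j ] ⟩} {K′}
            (subst₂ (λ l S → Cov K′ (𝔭 l ∷ antecedent S ⇒ succedent S)) (sym (↦-same σ i j)) (sym (tail-≡ (All.head new))) cD
            ∷ subst (λ l → Cov K′ ([ rpl (renameRPL π B) ] ⇒ 𝔭 l ∷ rpl (renameRPL π A) ∷ [])) (sym (↦-same σ i j)) cE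
            ∷ Covers-≡ new (Covers-mono g cs)) }
        where
        tail-≡ : ∀ {F F′ Γ Γ′ Δ Δ′} → (F ∷ Γ ⇒ Δ) ≡ (F′ ∷ Γ′ ⇒ Δ′) → (Γ ⇒ Δ) ≡ (Γ′ ⇒ Δ′)
        tail-≡ refl = refl

      sim-⇒⟶ : ∀ {G Γ Δ A B} →
        let H = (Γ ⇒ rpl (A ⟶ B) ∷ Δ) ∷ G in Covers K ρ H →
        (∀ {K′} → Covers K′ ρ ((Γ ⇒ Δ) ∷ H) → T K′) →
        (∀ {K′} → Covers K′ ρ ((rpl A ∷ Γ ⇒ rpl B ∷ Δ) ∷ H) → T K′) → T K
      sim-⇒⟶ cs@(c ∷ _) k₁ k₂ = apply-expand
        (λ {C} {G} k → T.⇒⟶ᵀ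
          (k (expand ⟶ʳ₁ ∼-refl first [] ∷ ≽-++ [ _ ] G) ⟶ʳ₁ first [])
          (k (expand ⟶ʳ₂ ∼-refl first [] ∷ ≽-++ [ _ ] G) ⟶ʳ₂ first []))
        c
        λ { g ⟶ʳ₁ cD [] → k₁ (cD ∷ Covers-mono g cs)
          ; g ⟶ʳ₂ cD [] → k₂ (cD ∷ Covers-mono g cs) }

      sim-⇒∀ : ∀ {G Γ Δ x A a} →
        let H = (Γ ⇒ rpl (all x A) ∷ Δ) ∷ G in a #ₐ H → Covers K ρ H →
        (∀ {ρ′ K′} → Covers K′ ρ′ ((Γ ⇒ rpl (A [ x ≔ param a ]) ∷ Δ) ∷ H) → T K′) → T K
      sim-⇒∀ {G} {Γ} {Δ} {x} {A} {a} a#H cs@(c ∷ _) k = apply-expand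
        (λ {C} {G} k → let b , b# = fresh-param ((at rhs (rpl (all x _)) ⊕ C) ∷ G) in
          T.⇒∀ᵀ b b# (k (expand (∀ʳ b) ∼-refl first [] ∷ ≽-++ [ _ ] G) (∀ʳ b) first []))
        c
        λ { {K′} g (∀ʳ b) cD [] → let new = rename-fresh-param {π} {σ} {a} {b} a#H in
          k {⟨ π [ a ↦ b ] , σ ⟩} {K′}
            (instantiate b (All.head new) cD ∷ Covers-≡ new (Covers-mono g cs)) }
        where
        instantiate : ∀ {K′} b → rename ⟨ π [ a ↦ b ] , σ ⟩ (Γ ⇒ rpl (all x A) ∷ Δ) ≡ rename ρ (Γ ⇒ rpl (all x A) ∷ Δ) →
          Cov K′ (map (renameFormula ρ) Γ ⇒ rpl (renameRPL π A [ x ≔ param b ]) ∷ map (renameFormula ρ) Δ) →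
          Cov K′ (rename ⟨ π [ a ↦ b ] , σ ⟩ (Γ ⇒ rpl (A [ x ≔ param a ]) ∷ Δ))
        instantiate b eq cD =
          let A-eq , Δ-eq = ∷-injective (cong succedent eq) in
          subst₂ (λ Γ Δ → Cov _ (Γ ⇒ _ ∷ Δ)) (sym (cong antecedent eq)) (sym Δ-eq)
            (subst (λ A → Cov _ (_ ⇒ rpl A ∷ _)) (sym (renameRPL-instance π a b x A (matrix-∀ A-eq))) cD)

      sim-∃⇒ : ∀ {G Γ Δ x A a} →
        let H = (rpl (ex x A) ∷ Γ ⇒ Δ) ∷ G in a #ₐ H → Covers K ρ H →
        (∀ {ρ′ K′} → Covers K′ ρ′ ((rpl (A [ x ≔ param a ]) ∷ Γ ⇒ Δ) ∷ H) → T K′) → T K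
      sim-∃⇒ {G} {Γ} {Δ} {x} {A} {a} a#H cs@(c ∷ _) k = apply-expand
        (λ {C} {G} k → let b , b# = fresh-param ((at lhs (rpl (ex x _)) ⊕ C) ∷ G) in
          T.∃⇒ᵀ b b# (k (expand (∃ˡ b) ∼-refl first [] ∷ ≽-++ [ _ ] G) (∃ˡ b) first []))
        c
        λ { {K′} g (∃ˡ b) cD [] → let new = rename-fresh-param {π} {σ} {a} {b} a#H in
          k {⟨ π [ a ↦ b ] , σ ⟩} {K′}
            (instantiate b (All.head new) cD ∷ Covers-≡ new (Covers-mono g cs)) }
        where
        instantiate : ∀ {K′} b → rename ⟨ π [ a ↦ b ] , σ ⟩ (rpl (ex x A) ∷ Γ ⇒ Δ) ≡ rename ρ (rpl (ex x A) ∷ Γ ⇒ Δ) →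
          Cov K′ (rpl (renameRPL π A [ x ≔ param b ]) ∷ map (renameFormula ρ) Γ ⇒ map (renameFormula ρ) Δ) →
          Cov K′ (rename ⟨ π [ a ↦ b ] , σ ⟩ (rpl (A [ x ≔ param a ]) ∷ Γ ⇒ Δ))
        instantiate b eq cD =
          let A-eq , Γ-eq = ∷-injective (cong antecedent eq) in
          subst₂ (λ Γ Δ → Cov _ (_ ∷ Γ ⇒ Δ)) (sym Γ-eq) (sym (cong succedent eq))
            (subst (λ A → Cov _ (rpl A ∷ _ ⇒ _)) (sym (renameRPL-instance π a b x A (matrix-∃ A-eq))) cD)

      sim-∀⇒ : ∀ {G Γ Δ x A t} → Closed t →
        let H = (rpl (all x A) ∷ Γ ⇒ Δ) ∷ G in Covers K ρ H →
        (∀ {K′} → Covers K′ ρ ((rpl (A [ x ≔ t ]) ∷ Γ ⇒ Δ) ∷ H) → T K′) → T K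
      -- `Expand` has no case for a universal formula on the left, so no earlier decomposition
      -- competes with the instance demanded here.
      sim-∀⇒ {G} {Γ} {Δ} {x} {A} {t} closed cs@(c ∷ _) k = apply {lhs} {all x (renameRPL π A)} {Instance} (λ ())
        (λ k → T.∀⇒ᵀ (renameTerm π t) (renameTerm-closed closed) λ g cI → k g (refl , refl) cI [])
        c
        λ { g (refl , refl) cI [] → k (subst (λ A → Cov _ (rpl A ∷ _ ⇒ _)) (sym (renameRPL-subst π A x t)) cI
              ∷ Covers-mono g cs) }
        where
        Instance : Sequent → List Sequent → Set
        Instance D E = D ≡ at lhs (rpl (renameRPL π A [ x ≔ renameTerm π t ])) × E ≡ []

      sim-⇒∃ : ∀ {G Γ Δ x A t} → Closed t →
        let H = (Γ ⇒ rpl (ex x A) ∷ Δ) ∷ G in Covers K ρ H →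
        (∀ {K′} → Covers K′ ρ ((Γ ⇒ rpl (A [ x ≔ t ]) ∷ Δ) ∷ H) → T K′) → T K
      sim-⇒∃ {G} {Γ} {Δ} {x} {A} {t} closed cs@(c ∷ _) k = apply {rhs} {ex x (renameRPL π A)} {Instance} (λ ())
        (λ k → T.⇒∃ᵀ (renameTerm π t) (renameTerm-closed closed) λ g cI → k g (refl , refl) cI [])
        c
        λ { g (refl , refl) cI [] → k (subst (λ A → Cov _ (_ ⇒ rpl A ∷ _)) (sym (renameRPL-subst π A x t)) cI
              ∷ Covers-mono g cs) }
        where
        Instance : Sequent → List Sequent → Set
        Instance D E = D ≡ at rhs (rpl (renameRPL π A [ x ≔ renameTerm π t ])) × E ≡ []

    Covers-≋ : ∀ {K ρ H H′} → H ≋ H′ → Covers K ρ H′ → Covers K ρ H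
    Covers-≋ {ρ = ρ} p = Permutation-All resp (≋-sym p)
      where
      resp : ∀ {K S T} → S ∼ T → Cov K (rename ρ S) → Cov K (rename ρ T)
      resp e = Cov-resp-∼ (rename-∼ ρ e)

    sim¹ : ∀ {H} → ⊢¹ H → ∀ {ρ K} → Covers K ρ H → T K
    sim¹ (exchange p d)    cs = sim¹ d (Covers-≋ p cs)
    sim¹ (axiom _ ax)      cs = T.axiomᵀ (Axiom-Cov cs ax)
    sim¹ (⟶⇒ i i#H d)      cs = sim-⟶⇒ i#H cs (sim¹ d)
    sim¹ (⇒⟶ d₁ d₂)        cs = sim-⇒⟶ cs (sim¹ d₁) (sim¹ d₂)
    sim¹ (∀⇒ t closed d)   cs = sim-∀⇒ closed cs (sim¹ d)
    sim¹ (⇒∀ a a#H d)      cs = sim-⇒∀ a#H cs (sim¹ d)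
    sim¹ (⇒∃ t closed d)   cs = sim-⇒∃ closed cs (sim¹ d)
    sim¹ (∃⇒ a a#H d)      cs = sim-∃⇒ a#H cs (sim¹ d)

    sim² : ∀ {H} → ⊢² H → ∀ {ρ K} → Covers K ρ H → T K
    sim² (exchange p d)    cs = sim² d (Covers-≋ p cs)
    sim² (axiom _ ax)      cs = T.axiomᵀ (Axiom-Cov cs ax)
    sim² (⟶⇒ i i#H d)      cs = sim-⟶⇒ i#H cs λ { (c ∷ c′ ∷ _ ∷ cs) → sim² d (c ∷ c′ ∷ cs) }
    sim² (⇒⟶ d₁ d₂)        cs = sim-⇒⟶ cs (λ { (c ∷ _ ∷ cs) → sim² d₁ (c ∷ cs) })
                                          (λ { (c ∷ _ ∷ cs) → sim² d₂ (c ∷ cs) })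
    sim² (∀⇒ t closed d)   cs = sim-∀⇒ closed cs (sim² d)
    sim² (⇒∀ a a#H d)      cs = sim-⇒∀ a#H cs λ { (c ∷ _ ∷ cs) → sim² d (c ∷ cs) }
    sim² (⇒∃ t closed d)   cs = sim-⇒∃ closed cs (sim² d)
    sim² (∃⇒ a a#H d)      cs = sim-∃⇒ a#H cs λ { (c ∷ _ ∷ cs) → sim² d (c ∷ cs) }

  -- Axioms of G² must not contain any `𝔮 i`, so derivability is made conditional on their absence,
  -- which passes from conclusions to premises.
  target² : Target (λ H → All Without𝔮ˢ H → ⊢² H)
  target² = record
    { exchangeᵀ = λ p d w → exchange p (d (Without𝔮-≋ (≋-sym p) w))
    ; axiomᵀ    = λ ax w → axiom (Without𝔮⇒# w) ax
    ; ⟶⇒ᵀ = λ { i i# d ((_ ∷ γ , δ) ∷ w) → ⟶⇒ i i# (d ((tt ∷ γ , δ) ∷ (tt ∷ [] , tt ∷ tt ∷ []) ∷ w)) }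
    ; ⇒⟶ᵀ = λ { d₁ d₂ ((γ , _ ∷ δ) ∷ w) → ⇒⟶ (d₁ ((γ , δ) ∷ w)) (d₂ ((tt ∷ γ , tt ∷ δ) ∷ w)) }
    ; ∀⇒ᵀ = λ { {G} t closed k w@((_ ∷ γ , δ) ∷ _) →
              ∀⇒ t closed (k (≽-++ [ _ ] _) first ((tt ∷ γ , δ) ∷ w)) }
    ; ⇒∀ᵀ = λ { a a# d ((γ , _ ∷ δ) ∷ w) → ⇒∀ a a# (d ((γ , tt ∷ δ) ∷ w)) }
    ; ⇒∃ᵀ = λ { t closed k w@((γ , _ ∷ δ) ∷ _) →
              ⇒∃ t closed (k (≽-++ [ _ ] _) first ((γ , tt ∷ δ) ∷ w)) }
    ; ∃⇒ᵀ = λ { a a# d ((_ ∷ γ , δ) ∷ w) → ∃⇒ a a# (d ((tt ∷ γ , δ) ∷ w)) }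
    }

  -- Of the three sequents in a premise of (∀⇒)³ or (⇒∃)³, the first and second are a cut of the
  -- conclusion at the new variable, and the first and third are a cut of the sequent with the
  -- instance.
  target³ : Target ⊢³_
  target³ = record
    { exchangeᵀ = exchange
    ; axiomᵀ    = axiom
    ; ⟶⇒ᵀ = ⟶⇒
    ; ⇒⟶ᵀ = ⇒⟶
    ; ∀⇒ᵀ = λ {G} {Γ} {Δ} {x} {A} t closed k → let i , i# = fresh-𝔭 _ in ∀⇒ i t closed i#
        (k (split {F = 𝔭 i} {at lhs (rpl (all x A))} {Γ ⇒ Δ} 𝔭 ∼-refl (member (there (here ∼-refl))) first ∷ ≽-++ (_ ∷ _ ∷ _ ∷ []) G)
           (split {F = 𝔭 i} {at lhs (rpl (A [ x ≔ t ]))} {Γ ⇒ Δ} 𝔭 ∼-refl (member (there (there (here ∼-refl)))) first))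
    ; ⇒∀ᵀ = ⇒∀
    ; ⇒∃ᵀ = λ {G} {Γ} {Δ} {x} {A} t closed k → let i , i# = fresh-𝔮 _ in ⇒∃ i t closed i#
        (k (split {F = 𝔮 i} {Γ ⇒ Δ} {at rhs (rpl (ex x A))} 𝔮 (⊕-comm (at rhs _) (Γ ⇒ Δ)) first (member (there (here ∼-refl))) ∷ ≽-++ (_ ∷ _ ∷ _ ∷ []) G)
           (split {F = 𝔮 i} {Γ ⇒ Δ} {at rhs (rpl (A [ x ≔ t ]))} 𝔮 (⊕-comm (at rhs _) (Γ ⇒ Δ)) first (member (there (there (here ∼-refl))))))
    ; ∃⇒ᵀ = ∃⇒
    }

  covers-itself : ∀ A → Covers [ [] ⇒ [ rpl A ] ] ⟨ id , id ⟩ [ [] ⇒ [ rpl A ] ]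
  covers-itself A = subst (λ B → Cov [ [] ⇒ [ rpl A ] ] ([] ⇒ [ rpl B ])) (sym (renameRPL-id A)) first ∷ []

  1⇒2 : ∀ {A} → Provable¹ A → Provable² A
  1⇒2 {A} d = sim¹ target² d {⟨ id , id ⟩} (covers-itself A) (([] , tt ∷ []) ∷ [])

  2⇒3 : ∀ {A} → Provable² A → Provable³ A
  2⇒3 {A} d = sim² target³ d {⟨ id , id ⟩} (covers-itself A)

-- Derivability in G¹ of valid sets of prenex formulas

module Completeness (Sg : Signature) where
  open Signature Sg
  open Calculi Sg
  open Syntax Sg
  open Semantics Sg
  open ℝ-Solver using (solve; _⊜_) renaming (_⊕_ to _:⊹_)

  module _ (M : HSInterpretation) (ν : ℕ → HSInterpretation.Dom M) (P Q : ℕ → ℝ) where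
    open Values M ν
    open Assignment P Q

    -- Falsity of the second sequent makes `𝔭 i` at most B minus A in shifted values; with
    -- `P i ≤ 1ℝ` it is then at most the implication, which it may replace on the left.
    True-⟶ˡ : ∀ i A B Γ Δ → P i ≤ 1ℝ → True (rpl (A ⟶ B) ∷ Γ ⇒ Δ) →
      ¬ True ([ rpl B ] ⇒ 𝔭 i ∷ rpl A ∷ []) → True (𝔭 i ∷ Γ ⇒ Δ)
    True-⟶ˡ i A B Γ Δ p≤1 t f = ⊑-trans (⊹-mono (⊓-glb (≤1⇒⊟1⊑0 p≤1) (⊹⊑⇒⊑⊟ p+a≤b)) ⊑-refl) t
      where
      p+a≤b : (P i ⊟ 1ℝ) ⊹ value₋₁ A ⊑ value₋₁ B
      p+a≤b = ⊑-trans (⊹-mono ⊑-refl (proj₂ (⊹-identityʳ (value₋₁ A))))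
                (⊑-trans (⋢⇒⊒ f) (proj₁ (⊹-identityʳ (value₋₁ B))))

    True-⟶ʳ₁ : ∀ A B Γ Δ → True (Γ ⇒ rpl (A ⟶ B) ∷ Δ) → True (Γ ⇒ Δ)
    True-⟶ʳ₁ A B Γ Δ t = ⊑-trans t (⊑-trans (⊹-mono (x⊓y⊑x _ _) ⊑-refl) (proj₁ (⊹-identityˡ (sum Δ))))

    True-⟶ʳ₂ : ∀ A B Γ Δ → True (Γ ⇒ rpl (A ⟶ B) ∷ Δ) → True (rpl A ∷ Γ ⇒ rpl B ∷ Δ)
    True-⟶ʳ₂ A B Γ Δ t = combine (value₋₁ (A ⟶ B)) t (⊑⊟⇒⊹⊑ (x⊓y⊑y 0ℝ (value₋₁ B ⊟ value₋₁ A)))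
      (solve 3 (λ m a γ → (a :⊹ γ) :⊹ m ⊜ γ :⊹ (m :⊹ a)) ≃-refl (value₋₁ (A ⟶ B)) (value₋₁ A) (sum Γ))
      (solve 3 (λ m b δ → (m :⊹ δ) :⊹ b ⊜ (b :⊹ δ) :⊹ m) ≃-refl (value₋₁ (A ⟶ B)) (value₋₁ B) (sum Δ))

    True-⟶ʳ : ∀ A B Γ Δ → True (Γ ⇒ Δ) → True (rpl A ∷ Γ ⇒ rpl B ∷ Δ) → True (Γ ⇒ rpl (A ⟶ B) ∷ Δ)
    True-⟶ʳ A B Γ Δ t₁ t₂ = ⊟⊑⇒⊑⊹ (⊓-glb (⊑⊹⇒⊟⊑ (⊑-trans t₁ (proj₂ (⊹-identityˡ (sum Δ)))))
      (⊹⊑⇒⊑⊟ (⊹-cancelʳ (sum Δ) (⊑-trans (proj₁ rearrange) (⊑-trans (⊹-mono ⊑-refl γ-δ) t₂)))))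
      where
      γ-δ = proj₁ (⊟-cancel (sum Γ) (sum Δ))
      rearrange = solve 3 (λ d a δ → (d :⊹ a) :⊹ δ ⊜ a :⊹ (d :⊹ δ)) ≃-refl (sum Γ ⊟ sum Δ) (value₋₁ A) (sum Δ)

  AnyTrue : Hypersequent → (M : HSInterpretation) → (ℕ → HSInterpretation.Dom M) → Set
  AnyTrue L M ν = Any (AtomicAndTrue M ν) L

  Trueᴹ : (M : HSInterpretation) → (ℕ → HSInterpretation.Dom M) → Sequent → Set
  Trueᴹ M ν = Values.Assignment.True M ν (HSInterpretation.𝔭ᴵ M) (HSInterpretation.𝔮ᴵ M)

  Trueᴹ-∼ : ∀ M ν {S T} → S ∼ T → Trueᴹ M ν S → Trueᴹ M ν T
  Trueᴹ-∼ M ν = Values.Assignment.True-resp-∼ M ν (HSInterpretation.𝔭ᴵ M) (HSInterpretation.𝔮ᴵ M)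

  Atomic-⊕ : ∀ {X Y} → Atomic X → Atomic Y → Atomic (X ⊕ Y)
  Atomic-⊕ (γ , δ) (γ′ , δ′) = Allₚ.++⁺ γ γ′ , Allₚ.++⁺ δ δ′

  infix 4 _∈̃_

  _∈̃_ : Sequent → Hypersequent → Set
  S ∈̃ L = Any (S ∼_) L

  -- In G¹ principal formulas are retained, so a quantifier-free formula can be
  -- replaced by atoms X in a new sequent that is true whenever the given one is.
  Reduced : Hypersequent → Sequent → Sequent → Set₁
  Reduced L S S′ = ∀ M ν → ¬ AnyTrue L M ν → Trueᴹ M ν S → Trueᴹ M ν S′

  -- The continuation is there because (⇒→)¹ branches: the rest of the derivation is carried out in
  -- each premise, with its own choice of X.
  reduce : ∀ s {A} → QuantifierFree A → ∀ C {L} → at s (rpl A) ⊕ C ∈̃ L → All Without𝔮ˢ L →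
    (∀ {L′} X → L ⊆ L′ → All Without𝔮ˢ L′ → Atomic X → X ⊕ C ∈̃ L′ →
       Reduced L′ (at s (rpl A) ⊕ C) (X ⊕ C) → ⊢¹ L′) →
    ⊢¹ L
  reduce s (pred {P = P} {ts}) C m w k = k (at s (rpl (pred P ts))) ⊆-refl w (atomic s) m λ _ _ _ t → t
    where
    atomic : ∀ s → Atomic (at s (rpl (pred P ts)))
    atomic lhs = pred ∷ [] , []
    atomic rhs = [] , pred ∷ []
  reduce s (const {r} {p} {q}) C m w k = k (at s (rpl (const r p q))) ⊆-refl w (atomic s) m λ _ _ _ t → t
    where
    atomic : ∀ s → Atomic (at s (rpl (const r p q)))
    atomic lhs = const ∷ [] , []
    atomic rhs = [] , const ∷ []
  reduce lhs (_⟶_ {A} {B} a b) C {L} m w k with to-front m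
  ... | G , p with fresh-𝔭 ((at lhs (rpl (A ⟶ B)) ⊕ C) ∷ G) | Without𝔮-≋ (≋-sym p) w
  ...   | i , i# | (_ ∷ γ , δ) ∷ _ = exchange p (⟶⇒ i i# (exchange (prep ∼-refl (prep ∼-refl (≋-sym p)))
    -- The sequent `B ⇒ 𝔭 i, A` has to be reduced to atoms as well. Only then does the absence of
    -- true atomic sequents refute it, as `True-⟶ˡ` demands.
    (reduce lhs b ([] ⇒ 𝔭 i ∷ rpl A ∷ []) (there (here ∼-refl))
      ((tt ∷ γ , δ) ∷ (tt ∷ [] , tt ∷ tt ∷ []) ∷ w)
      λ X L₁⊆ w₁ atomX m₁ red₁ →
        reduce rhs a (X ⊕ at rhs (𝔭 i))
          (Any.map (∼-trans (commute X)) m₁) w₁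
          λ {L₂} Y L₂⊆ w₂ atomY m₂ red₂ →
            k (at lhs (𝔭 i)) (λ S∈L → L₂⊆ (L₁⊆ (there (there S∈L)))) w₂ (𝔭 ∷ [] , [])
              (Any-resp-⊆ L₂⊆ (Any-resp-⊆ L₁⊆ (here ∼-refl)))
              λ M ν ¬any t →
                True-⟶ˡ M ν _ _ i A B (antecedent C) (succedent C) (HSInterpretation.𝔭ᴵ≤1 M i) t λ t₁ →
                  Values.Cov-True M ν (member m₂) (Atomic-⊕ atomY (Atomic-⊕ atomX ([] , 𝔭 ∷ [])))
                    (red₂ M ν ¬any (Trueᴹ-∼ M ν (∼-sym (commute X))
                      (red₁ M ν (¬any ∘ Any-resp-⊆ L₂⊆) t₁))) ¬any)))
    where
    commute : ∀ X → at rhs (rpl A) ⊕ (X ⊕ at rhs (𝔭 i)) ∼ X ⊕ ([] ⇒ 𝔭 i ∷ rpl A ∷ [])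
    commute X = ∼-trans (⊕-swap (at rhs (rpl A)) X (at rhs (𝔭 i)))
      (⊕-cong (∼-refl {X}) (↭.refl , ↭.swap _ _ ↭.refl))
  reduce rhs (_⟶_ {A} {B} a b) C {L} m w k with to-front m
  ... | G , p with Without𝔮-≋ (≋-sym p) w
  ...   | (γ , _ ∷ δ) ∷ _ = exchange p (⇒⟶
    (exchange (prep ∼-refl (≋-sym p))
      (k ([] ⇒ []) there ((γ , δ) ∷ w) ([] , []) (here ∼-refl)
        λ M ν _ → True-⟶ʳ₁ M ν _ _ A B (antecedent C) (succedent C)))
    (exchange (prep ∼-refl (≋-sym p))
      (reduce lhs a (at rhs (rpl B) ⊕ C) (here ∼-refl) ((tt ∷ γ , tt ∷ δ) ∷ w)
        λ X L₁⊆ w₁ atomX m₁ red₁ →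
          reduce rhs b (X ⊕ C) (Any.map (∼-trans (⊕-swap (at rhs (rpl B)) X C)) m₁) w₁
            λ Y L₂⊆ w₂ atomY m₂ red₂ →
              k (Y ⊕ X) (λ S∈L → L₂⊆ (L₁⊆ (there S∈L))) w₂ (Atomic-⊕ atomY atomX)
                (Any.map (∼-trans (⊕-assoc Y X C)) m₂)
                λ M ν ¬any t →
                  Trueᴹ-∼ M ν (∼-sym (⊕-assoc Y X C)) (red₂ M ν ¬any
                    (Trueᴹ-∼ M ν (⊕-swap X (at rhs (rpl B)) C)
                      (red₁ M ν (¬any ∘ Any-resp-⊆ L₂⊆)
                        (True-⟶ʳ₂ M ν _ _ A B (antecedent C) (succedent C) t)))))))

  hyper : List RPL → Hypersequent
  hyper = map (λ F → [] ⇒ [ rpl F ])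

  reduce-all : ∀ {Ξ} → All Prenex Ξ → ∀ {L} → All (λ F → ([] ⇒ [ rpl F ]) ∈̃ L) Ξ → All Without𝔮ˢ L →
    (∀ {L′} → L ⊆ L′ → All Without𝔮ˢ L′ →
       (∀ M ν → ¬ AnyTrue L′ M ν → All (λ F → ¬ (0ℝ ⊑ Values.value₋₁ M ν F)) Ξ) → ⊢¹ L′) →
    ⊢¹ L
  reduce-all []                    []       w k = k ⊆-refl w λ _ _ _ → []
  reduce-all (qf {A} q ∷ prs)      (m ∷ ms) w k = reduce rhs q ([] ⇒ []) m w
    λ X L⊆ w₁ atomX m₁ red → reduce-all prs (All.map (Any-resp-⊆ L⊆) ms) w₁
      λ L₁⊆ w₂ false → k (L₁⊆ ∘ L⊆) w₂ λ M ν ¬any →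
        (λ t → Values.Cov-True M ν (member (Any-resp-⊆ L₁⊆ m₁)) (Atomic-⊕ atomX ([] , []))
          (red M ν (¬any ∘ Any-resp-⊆ L₁⊆) (⊑-trans t (proj₂ (⊹-identityʳ _)))) ¬any)
        ∷ false M ν ¬any
  -- By the default value, a formula beginning with a quantifier is below 1 in every interpretation,
  -- without any step in G¹.
  reduce-all (all _ ∷ prs) (m ∷ ms) w k = reduce-all prs ms w
    λ L⊆ w₁ false → k L⊆ w₁ λ M ν ¬any → 0⋢-1 ∷ false M ν ¬any
  reduce-all (ex _ ∷ prs)  (m ∷ ms) w k = reduce-all prs ms w
    λ L⊆ w₁ false → k L⊆ w₁ λ M ν ¬any → 0⋢-1 ∷ false M ν ¬any

  -- After all quantifier-free members are reduced, an interpretation with no true atomic sequent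
  -- would put all of Θ below 1, against validity. What is reached is thus an axiom.
  complete : ∀ {Θ} → All Prenex Θ →
    (∀ M ν → ¬ All (λ F → ¬ (0ℝ ⊑ Values.value₋₁ M ν F)) Θ) → ⊢¹ hyper Θ
  complete {Θ} prs valid = reduce-all prs
    (All.tabulate λ F∈Θ → Any.map (λ { refl → ∼-refl }) (∈-map⁺ _ F∈Θ))
    (Allₚ.map⁺ (All.tabulate λ _ → [] , tt ∷ []))
    λ _ w false → axiom (Without𝔮⇒# w) λ M ν ¬any → valid M ν (false M ν ¬any)

-- From G³ to G¹ for prenex formulas

module Elimination (Sg : Signature) where
  open Signature Sg
  open Calculi Sg
  open Syntax Sg
  open Semantics Sg
  open Translation Sg
  open Completeness Sg

  QuantifierFree-subst : ∀ {A x t} → QuantifierFree A → QuantifierFree (A [ x ≔ t ])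
  QuantifierFree-subst pred    = pred
  QuantifierFree-subst const   = const
  QuantifierFree-subst (a ⟶ b) = QuantifierFree-subst a ⟶ QuantifierFree-subst b

  Prenex-subst : ∀ {A x t} → Prenex A → Prenex (A [ x ≔ t ])
  Prenex-subst (qf q) = qf (QuantifierFree-subst q)
  Prenex-subst {x = x} (all {y} p) with x ℕₚ.≟ y
  ... | yes _ = all p
  ... | no  _ = all (Prenex-subst p)
  Prenex-subst {x = x} (ex {y} p) with x ℕₚ.≟ y
  ... | yes _ = ex p
  ... | no  _ = ex (Prenex-subst p)

  Prenex-matrix-∀ : ∀ {x A} → Prenex (all x A) → Prenex A
  Prenex-matrix-∀ (all p) = p

  Prenex-matrix-∃ : ∀ {x A} → Prenex (ex x A) → Prenex A
  Prenex-matrix-∃ (ex p) = p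

  data QuantifierFreeᶠ : Formula → Set where
    rpl : ∀ {A} → QuantifierFree A → QuantifierFreeᶠ (rpl A)
    𝔭   : ∀ {i} → QuantifierFreeᶠ (𝔭 i)
    𝔮   : ∀ {i} → QuantifierFreeᶠ (𝔮 i)

  data Origin : List Formula → Set where
    none : Origin []
    𝔮    : ∀ {i} → Origin [ 𝔮 i ]

  -- The sequents that occur in a G³-proof of a prenex formula; Θ collects all its
  -- instances met so far, and the variable 𝔮 of Origin stems from (⇒∃)³.
  data Tracked (π : ℕ → ℕ) (Θ : List RPL) : Sequent → Set where
    quantifier-free : ∀ {Γ Δ} → All QuantifierFreeᶠ Γ → All QuantifierFreeᶠ Δ → Tracked π Θ (Γ ⇒ Δ)
    prenex : ∀ {Γ F} → Origin Γ → Prenex F → renameRPL π F ∈ Θ → Tracked π Θ (Γ ⇒ [ rpl F ])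

  Origin-↭ : ∀ {Γ Γ′} → Γ ↭ Γ′ → Origin Γ → Origin Γ′
  Origin-↭ p none with ↭ₚ.↭-empty-inv (↭.↭-sym p)
  ... | refl = none
  Origin-↭ p 𝔮 with ↭ₚ.↭-singleton-inv (↭.↭-sym p)
  ... | refl = 𝔮

  Origin-quantifier-free : ∀ {Γ} → Origin Γ → All QuantifierFreeᶠ Γ
  Origin-quantifier-free none = []
  Origin-quantifier-free 𝔮    = 𝔮 ∷ []

  Tracked-⟶ : ∀ {π Θ Γ A B Δ} → Tracked π Θ (Γ ⇒ rpl (A ⟶ B) ∷ Δ) →
    All QuantifierFreeᶠ Γ × QuantifierFree (A ⟶ B) × All QuantifierFreeᶠ Δ
  Tracked-⟶ (quantifier-free γ (rpl q ∷ δ)) = γ , q , δ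
  Tracked-⟶ (prenex o (qf q) _)             = Origin-quantifier-free o , q , []

  Tracked-∼ : ∀ {π Θ S T} → S ∼ T → Tracked π Θ S → Tracked π Θ T
  Tracked-∼ (p , q) (quantifier-free γ δ) = quantifier-free (↭ₚ.All-resp-↭ p γ) (↭ₚ.All-resp-↭ q δ)
  Tracked-∼ (p , q) (prenex o pr F∈Θ) with ↭ₚ.↭-singleton-inv (↭.↭-sym q)
  ... | refl = prenex (Origin-↭ p o) pr F∈Θ

  Tracked-mono : ∀ {π Θ Θ′ S} → Θ ⊆ Θ′ → Tracked π Θ S → Tracked π Θ′ S
  Tracked-mono sub (quantifier-free γ δ) = quantifier-free γ δ
  Tracked-mono sub (prenex o pr F∈Θ)     = prenex o pr (sub F∈Θ)

  paramsOnly : (ℕ → ℕ) → Renaming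
  paramsOnly π = ⟨ π , id ⟩

  Tracked-rename : ∀ {π π′ Θ S} → rename (paramsOnly π′) S ≡ rename (paramsOnly π) S → Tracked π Θ S → Tracked π′ Θ S
  Tracked-rename eq (quantifier-free γ δ) = quantifier-free γ δ
  Tracked-rename {Θ = Θ} eq (prenex o pr F∈Θ) =
    prenex o pr (subst (_∈ Θ) (sym (rpl-injective (∷-injectiveˡ (cong succedent eq)))) F∈Θ)
    where
    rpl-injective : ∀ {A B} → Formula.rpl A ≡ rpl B → A ≡ B
    rpl-injective refl = refl

  -- Principal formulas are retained in G¹, so Θ only grows. The eigenparameter must be fresh for Θ,
  -- hence the premise is asked for every b.
  instantiate-∀ : ∀ {Θ x A} → all x A ∈ Θ → (∀ b → ⊢¹ hyper (A [ x ≔ param b ] ∷ Θ)) → ⊢¹ hyper Θ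
  instantiate-∀ m d with to-front (Any.map (λ { refl → ∼-refl }) (∈-map⁺ (λ F → [] ⇒ [ rpl F ]) m))
  ... | G , p = let b , b# = fresh-param _ in
    exchange p (⇒∀ b b# (exchange (prep ∼-refl (≋-sym p)) (d b)))

  instantiate-∃ : ∀ {Θ x A t} → ex x A ∈ Θ → Closed t → ⊢¹ hyper (A [ x ≔ t ] ∷ Θ) → ⊢¹ hyper Θ
  instantiate-∃ m c d with to-front (Any.map (λ { refl → ∼-refl }) (∈-map⁺ (λ F → [] ⇒ [ rpl F ]) m))
  ... | G , p = exchange p (⇒∃ _ c (exchange (prep ∼-refl (≋-sym p)) d))

  module _ (M : HSInterpretation) (ν : ℕ → HSInterpretation.Dom M) where
    open Values M ν
    open Assignment

    -- The first bound is the junk value of quantified formulas, minus 1.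
    bounds : List RPL → List ℝ
    bounds Θ = (0ℝ ⊟ 1ℝ) ∷ map value₋₁ Θ

    Above : List RPL → ℝ → Set
    Above Θ x = All (λ v → ¬ (x ⊑ v)) (bounds Θ)

    Above-≃ : ∀ {Θ x y} → x ≃ y → Above Θ x → Above Θ y
    Above-≃ e = All.map λ x⋢v y⊑v → x⋢v (⊑-trans (proj₁ e) y⊑v)

    Above-⊆ : ∀ {Θ Θ′ x} → Θ ⊆ Θ′ → Above Θ′ x → Above Θ x
    Above-⊆ sub (a ∷ as) = a ∷ Allₚ.map⁺ (All-resp-⊇ sub (Allₚ.map⁻ as))

    Above-∈ : ∀ {Θ x F} → Above Θ x → F ∈ Θ → ¬ (x ⊑ value₋₁ F)
    Above-∈ (_ ∷ as) F∈Θ = All.lookup (Allₚ.map⁻ as) F∈Θ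

    -- The antecedent of a prenex sequent is worth 0 or the shifted value of a single `𝔮 i`; both
    -- exceed all bounds of Θ.
    Above-Origin : ∀ {P Q Θ π Γ} → Above Θ 0ℝ → (∀ i → Above Θ (Q i ⊟ 1ℝ)) → Origin Γ →
                   Above Θ (sum P Q (map (renameFormula (paramsOnly π)) Γ))
    Above-Origin a₀ a none = a₀
    Above-Origin a₀ a 𝔮    = Above-≃ (≃-sym (⊹-identityʳ _)) (a _)

    False : (ℕ → ℕ) → (P Q : ℕ → ℝ) → Sequent → Set
    False π P Q S = ¬ True P Q (rename (paramsOnly π) S)

    SameSums : (π : ℕ → ℕ) (P Q P′ Q′ : ℕ → ℝ) → Sequent → Set
    SameSums π P Q P′ Q′ S = same (antecedent S) × same (succedent S)
      where
      same : List Formula → Set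
      same Γ = sum P Q (map (renameFormula (paramsOnly π)) Γ) ≡ sum P′ Q′ (map (renameFormula (paramsOnly π)) Γ)

    sum-fresh : ∀ {π P Q P′ Q′} {R : Formula → Set} →
      (∀ F → ¬ R F → formula₋₁ P Q (renameFormula (paramsOnly π) F) ≡ formula₋₁ P′ Q′ (renameFormula (paramsOnly π) F)) →
      ∀ {H} → ¬ SomeMember R H → All (SameSums π P Q P′ Q′) H
    sum-fresh eq {[]}    fr = []
    sum-fresh {π} {P} {Q} {P′} {Q′} {R} eq {S ∷ H} fr =
      (agree _ (fr ∘ here ∘ inj₁) , agree _ (fr ∘ here ∘ inj₂)) ∷ sum-fresh eq (fr ∘ there)
      where
      agree : ∀ Γ → ¬ Any R Γ →
        sum P Q (map (renameFormula (paramsOnly π)) Γ) ≡ sum P′ Q′ (map (renameFormula (paramsOnly π)) Γ)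
      agree []      _  = refl
      agree (F ∷ Γ) fr = cong₂ _⊹_ (eq F (fr ∘ here)) (agree Γ (fr ∘ there))

    sum-fresh-𝔭 : ∀ {π P Q i x H} → 𝔭 i # H → All (SameSums π P Q (P [ i ↦ x ]) Q) H
    sum-fresh-𝔭 {π} {P} {i = i} {x} = sum-fresh λ
      { (rpl A) _   → refl
      ; (𝔭 k)   i≢k → cong (_⊟ 1ℝ) (sym (↦-other P i x λ { refl → i≢k refl }))
      ; (𝔮 k)   _   → refl }

    sum-fresh-𝔮 : ∀ {π P Q i x H} → 𝔮 i # H → All (SameSums π P Q P (Q [ i ↦ x ])) H
    sum-fresh-𝔮 {π} {Q = Q} {i = i} {x} = sum-fresh λ
      { (rpl A) _   → refl
      ; (𝔭 k)   _   → refl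
      ; (𝔮 k)   i≢k → cong (_⊟ 1ℝ) (sym (↦-other Q i x λ { refl → i≢k refl })) }

    False-same : ∀ {π P Q P′ Q′ H} → All (SameSums π P Q P′ Q′) H → All (False π P Q) H → All (False π P′ Q′) H
    False-same eqs fs = All.zipWith (λ ((p , q) , f) → subst₂ (λ x y → ¬ (x ⊑ y)) p q f) (eqs , fs)

  -- The 𝔮 i stand for truth values strictly between those of Θ and 1.
  Valid : (ℕ → ℕ) → Hypersequent → List RPL → Set₁
  Valid π H Θ = ∀ M ν P Q → (∀ i → P i ≤ 1ℝ) → (∀ i → 0ℝ ≤ Q i) →
    Above M ν Θ 0ℝ → (∀ i → Above M ν Θ (Q i ⊟ 1ℝ)) → ¬ All (False M ν π P Q) H

  Valid-⊆ : ∀ {π H Θ Θ′} → Θ ⊆ Θ′ → Valid π H Θ → Valid π H Θ′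
  Valid-⊆ sub v M ν P Q p q a₀ a = v M ν P Q p q (Above-⊆ M ν sub a₀) (λ i → Above-⊆ M ν sub (a i))

  Valid-≋ : ∀ {π H H′ Θ} → H ≋ H′ → Valid π H Θ → Valid π H′ Θ
  Valid-≋ {π} p v M ν P Q p≤1 q≥0 a₀ a fs = v M ν P Q p≤1 q≥0 a₀ a (Permutation-All resp (≋-sym p) fs)
    where
    resp : ∀ {S T} → S ∼ T → False M ν π P Q S → False M ν π P Q T
    resp e f t = f (Values.Assignment.True-resp-∼ M ν P Q (rename-∼ (paramsOnly π) (∼-sym e)) t)

  Valid-axiom : ∀ {π H Θ} → Axiom H → Valid π H Θ
  Valid-axiom {π} ax M ν P Q p q _ _ fs =
    Reinterpret.Axiom⇒True M ν P Q p q (paramsOnly π) ax λ any → let f , (_ , t) = All.lookupAny fs any in f t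

  #-tailˡ : ∀ {F E Γ Δ G} → F # ((E ∷ Γ ⇒ Δ) ∷ G) → F # ((Γ ⇒ Δ) ∷ G)
  #-tailˡ fr (here (inj₁ m)) = fr (here (inj₁ (there m)))
  #-tailˡ fr (here (inj₂ m)) = fr (here (inj₂ m))
  #-tailˡ fr (there m)       = fr (there m)

  #-tailʳ : ∀ {F E Γ Δ G} → F # ((Γ ⇒ E ∷ Δ) ∷ G) → F # ((Γ ⇒ Δ) ∷ G)
  #-tailʳ fr (here (inj₁ m)) = fr (here (inj₁ m))
  #-tailʳ fr (here (inj₂ m)) = fr (here (inj₂ (there m)))
  #-tailʳ fr (there m)       = fr (there m)

  updated-⊟1 : ∀ f i r → (f [ i ↦ fromℚ (r +ℚ 1ℚ) ]) i ⊟ 1ℝ ≃ fromℚ r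
  updated-⊟1 f i r = subst (λ x → x ⊟ 1ℝ ≃ fromℚ r) (sym (↦-same f i (fromℚ (r +ℚ 1ℚ)))) (+1-⊟1 r)

  -- Falsity of the conclusion puts the implication strictly above Δ minus Γ. A rational r strictly
  -- between the two, taken as the shifted value of `𝔭 i`, falsifies both new sequents.
  Valid-⟶⇒ : ∀ {π i A B Γ Δ G Θ} → let H = (rpl (A ⟶ B) ∷ Γ ⇒ Δ) ∷ G in 𝔭 i # H →
    Valid π ((𝔭 i ∷ Γ ⇒ Δ) ∷ (rpl B ∷ [] ⇒ 𝔭 i ∷ rpl A ∷ []) ∷ G) Θ → Valid π H Θ
  Valid-⟶⇒ {π} {i} {A} {B} {Γ} {Δ} {G} i# v M ν P Q p q a₀ a (f ∷ fs) =
    between {value₋₁ (A′ ⟶ B′)} {sum P Q Δ′ ⊟ sum P Q Γ′} (λ h → f (⊑⊟⇒⊹⊑ h)) λ { (r , m⋢r , r⋢) →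
      let P′ = P [ i ↦ fromℚ (r +ℚ 1ℚ) ]
          pᵢ = updated-⊟1 P i r
          r⊑m = ⋢⇒⊒ m⋢r
          eqs = sum-fresh-𝔭 M ν {π} {P} {Q} {i} {fromℚ (r +ℚ 1ℚ)} (#-tailˡ {𝔭 i} {rpl (A ⟶ B)} i#)
          Γ-eq , Δ-eq = All.head eqs
      in v M ν P′ Q
        -- The implication is a minimum with 0 and r lies below it, so r + 1 is an admissible value
        -- of type 1.
        (↦-elim (_≤ 1ℝ) P i _ (⊟1⊑0⇒≤1 (⊑-trans (proj₁ (+1-⊟1 r)) (⊑-trans r⊑m (x⊓y⊑x _ _)))) p) q a₀ a
        ( (λ t → r⋢ (⊹⊑⇒⊑⊟ (⊑-trans (⊹-mono (proj₂ pᵢ) ⊑-refl)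
            (subst₂ (λ x y → (P′ i ⊟ 1ℝ) ⊹ x ⊑ y) (sym Γ-eq) (sym Δ-eq) t))))
        ∷ (λ t → m⋢r (⊑-trans (x⊓y⊑y _ _) (⊑⊹⇒⊟⊑ (⊑-trans (proj₂ (⊹-identityʳ _))
            (⊑-trans t (⊹-mono (proj₁ pᵢ) (proj₁ (⊹-identityʳ _))))))))
        ∷ False-same M ν {π} {P} {Q} {P′} {Q} (All.tail eqs) fs) }
    where
    open Values M ν
    open Assignment
    A′ = renameRPL π A
    B′ = renameRPL π B
    Γ′ = map (renameFormula (paramsOnly π)) Γ
    Δ′ = map (renameFormula (paramsOnly π)) Δ

  Valid-⇒⟶ : ∀ {π A B Γ Δ G Θ} →
    Valid π ((Γ ⇒ Δ) ∷ G) Θ → Valid π ((rpl A ∷ Γ ⇒ rpl B ∷ Δ) ∷ G) Θ →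
    Valid π ((Γ ⇒ rpl (A ⟶ B) ∷ Δ) ∷ G) Θ
  Valid-⇒⟶ {π} {A} {B} {Γ} {Δ} v₁ v₂ M ν P Q p q a₀ a (f ∷ fs) =
    v₁ M ν P Q p q a₀ a ((λ t₁ → v₂ M ν P Q p q a₀ a ((λ t₂ → f
      (True-⟶ʳ M ν P Q (renameRPL π A) (renameRPL π B) (map (renameFormula (paramsOnly π)) Γ)
        (map (renameFormula (paramsOnly π)) Δ) t₁ t₂)) ∷ fs)) ∷ fs)

  -- A value for 𝔮 i is chosen below that of Γ and above those of all F ∈ Θ.
  Valid-⇒∃ : ∀ {π i x A t Γ G Θ} → let H = (Γ ⇒ [ rpl (ex x A) ]) ∷ G in 𝔮 i # H → Origin Γ →
    renameRPL π (A [ x ≔ t ]) ∈ Θ →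
    Valid π ((Γ ⇒ [ 𝔮 i ]) ∷ ([ 𝔮 i ] ⇒ [ rpl (ex x A) ]) ∷ ([ 𝔮 i ] ⇒ [ rpl (A [ x ≔ t ]) ]) ∷ G) Θ → Valid π H Θ
  Valid-⇒∃ {π} {i} {x} {A} {t} {Γ} {G} {Θ} i# o A∈Θ v M ν P Q p q a₀ a (f ∷ fs)
    with u⋢-1 ∷ u⋢ ← Above-Origin M ν {P} {Q} {π = π} a₀ a o =
    between-all u⋢-1 u⋢ λ { (r , u⋢r , r⋢@(r⋢-1 ∷ _)) →
      let Q′ = Q [ i ↦ fromℚ (r +ℚ 1ℚ) ]
          qᵢ = updated-⊟1 Q i r
          eqs = sum-fresh-𝔮 M ν {π} {P} {Q} {i} {fromℚ (r +ℚ 1ℚ)} (#-tailʳ {𝔮 i} {rpl (ex x A)} i#)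
          Γ-eq , _ = All.head eqs
      in v M ν P Q′ p
        -- Lying above the default bound -1, r makes r + 1 an admissible value of type 0. The same
        -- bound falsifies the retained sequent with the existential formula, whose default value is
        -- 0.
        (↦-elim (0ℝ ≤_) Q i _ (-1⊑⊟1⇒≥0 (⊑-trans (⋢⇒⊒ r⋢-1) (proj₂ (+1-⊟1 r)))) q) a₀
        (↦-elim (λ x → Above M ν Θ (x ⊟ 1ℝ)) Q i _ (Above-≃ M ν (≃-sym (+1-⊟1 r)) r⋢) a)
        ( (λ h → u⋢r (⊑-trans (subst (_⊑ _) (sym Γ-eq) h) (⊑-trans (proj₁ (⊹-identityʳ _)) (proj₁ qᵢ))))
        ∷ (λ h → r⋢-1 (drop-0 qᵢ h))
        ∷ (λ h → Above-∈ M ν r⋢ A∈Θ (drop-0 qᵢ h))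
        ∷ False-same M ν {π} {P} {Q} {P} {Q′} (All.tail eqs) fs) }
    where
    drop-0 : ∀ {x y z} → x ≃ y → x ⊹ 0ℝ ⊑ z ⊹ 0ℝ → y ⊑ z
    drop-0 e h = ⊑-trans (proj₂ e) (⊹-cancelʳ 0ℝ h)

  -- The sequent with the instance is false since its formula lies in Θ, while its antecedent
  -- exceeds all of Θ; the other sequents have the same renaming under `π` and `π′`.
  Valid-⇒∀ : ∀ {π π′ x A I Γ G Θ B} → Origin Γ → B ∈ Θ → renameRPL π′ I ≡ B →
    All (λ S → rename (paramsOnly π′) S ≡ rename (paramsOnly π) S) G →
    Valid π′ ((Γ ⇒ [ rpl I ]) ∷ G) Θ → Valid π ((Γ ⇒ [ rpl (all x A) ]) ∷ G) Θ
  Valid-⇒∀ {π} {π′} o B∈Θ refl eqs v M ν P Q p q a₀ a (_ ∷ fs) = v M ν P Q p q a₀ a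
    ((λ t → Above-∈ M ν (Above-Origin M ν {P} {Q} {π = π′} a₀ a o) B∈Θ (⊑-trans t (proj₁ (⊹-identityʳ _))))
    ∷ All.zipWith (λ (eq , f) t → f (subst (Values.Assignment.True M ν P Q) eq t)) (eqs , fs))

  -- The continuation is called at the axioms, and each rule extends it by the lemma that carries
  -- `Valid` from premises to conclusion. Both branches of (⇒→)³ contribute to one Θ and may share
  -- eigenparameters, so `π` sends these to the parameters chosen in G¹.
  eliminate : ∀ {H} → ⊢³ H → ∀ {π Θ} → All Prenex Θ → All (Tracked π Θ) H →
    (∀ {Θ′} → Θ ⊆ Θ′ → All Prenex Θ′ → Valid π H Θ′ → ⊢¹ hyper Θ′) → ⊢¹ hyper Θ
  eliminate (exchange p d) prs ts k = eliminate d prs (Permutation-All Tracked-∼ (≋-sym p) ts)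
    λ sub prs′ v → k sub prs′ (Valid-≋ p v)
  eliminate (axiom ax) prs ts k = k ⊆-refl prs (Valid-axiom ax)
  eliminate (⟶⇒ {A = A} {B} i i# d) prs (quantifier-free (rpl (a ⟶ b) ∷ γ) δ ∷ ts) k =
    eliminate d prs (quantifier-free (𝔭 ∷ γ) δ ∷ quantifier-free (rpl b ∷ []) (𝔭 ∷ rpl a ∷ []) ∷ ts)
      λ sub prs′ v → k sub prs′ (Valid-⟶⇒ i# v)
  eliminate (⇒⟶ d₁ d₂) prs (t ∷ ts) k with Tracked-⟶ t
  ... | γ , (a ⟶ b) , δ = eliminate d₁ prs (quantifier-free γ δ ∷ ts) λ sub₁ prs₁ v₁ →
    eliminate d₂ prs₁ (quantifier-free (rpl a ∷ γ) (rpl b ∷ δ) ∷ All.map (Tracked-mono sub₁) ts)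
      λ sub₂ prs₂ v₂ → k (sub₂ ∘ sub₁) prs₂ (Valid-⇒⟶ (Valid-⊆ sub₂ v₁) v₂)
  -- Quantified formulas occur only in `prenex` sequents, and there only on the right.
  eliminate (∀⇒ _ _ _ _ _) prs (quantifier-free (rpl () ∷ _) _ ∷ _) k
  eliminate (∃⇒ _ _ _)     prs (quantifier-free (rpl () ∷ _) _ ∷ _) k
  eliminate (⇒∀ _ _ _)     prs (quantifier-free _ (rpl () ∷ _) ∷ _) k
  eliminate (⇒∃ _ _ _ _ _) prs (quantifier-free _ (rpl () ∷ _) ∷ _) k
  eliminate (⇒∀ {G} {x = x} {A} a a# d) {π} {Θ} prs (prenex o (all pr) F∈Θ ∷ ts) k = instantiate-∀ F∈Θ λ b →
    let eqs = rename-fresh-param {π} {id} {a} {b} a#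
        A-eq = renameRPL-instance π a b x A (matrix-∀ (∷-injectiveˡ (cong succedent (All.head eqs))))
    in eliminate d (Prenex-subst (Prenex-matrix-∀ (All.lookup prs F∈Θ)) ∷ prs)
      (prenex o (Prenex-subst pr) (here A-eq)
        ∷ All.zipWith (λ (eq , t) → Tracked-rename eq (Tracked-mono there t)) (All.tail eqs , ts))
      λ sub prs′ v → k (sub ∘ there) prs′ (Valid-⇒∀ {x = x} o (sub (here refl)) A-eq (All.tail eqs) v)
  eliminate (⇒∃ {x = x} {A} i t closed i# d) {π} prs (prenex {Γ = Γ} o (ex pr) F∈Θ ∷ ts) k =
    instantiate-∃ F∈Θ (renameTerm-closed closed)
      (eliminate d (Prenex-subst (Prenex-matrix-∃ (All.lookup prs F∈Θ)) ∷ prs)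
        ( quantifier-free (Origin-quantifier-free o) (𝔮 ∷ [])
        ∷ prenex 𝔮 (ex pr) (there F∈Θ)
        ∷ prenex 𝔮 (Prenex-subst pr) (here (renameRPL-subst π A x t))
        ∷ All.map (Tracked-mono there) ts)
        λ {Θ′} sub prs′ v → k (sub ∘ there) prs′ (Valid-⇒∃ {t = t} i# o (subst (_∈ Θ′) (sym (renameRPL-subst π A x t)) (sub (here refl))) v))

  3⇒1 : ∀ {A} → Prenex A → Provable³ A → Provable¹ A
  3⇒1 {A} pr d = eliminate d (pr ∷ []) (prenex none pr (here (renameRPL-id A)) ∷ [])
    λ sub prs v → complete prs λ M ν fs →
      -- If all of Θ were below 1, a rational r would lie strictly between the shifted values and 0.
      -- Giving every `𝔮 i` the value r + 1 and every `𝔭 i` the value 1 meets the conditions of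
      -- `Valid`, and `⇒ A` is false because A belongs to Θ.
      between-all 0⋢-1 (Allₚ.map⁺ fs) λ { (r , 0⋢r , r⋢@(r⋢-1 ∷ _)) →
        v M ν (λ _ → 1ℝ) (λ _ → fromℚ (r +ℚ 1ℚ)) (λ _ → ⊑⇒≤ (⊑-refl {1ℝ}))
          (λ _ → -1⊑⊟1⇒≥0 (⊑-trans (⋢⇒⊒ r⋢-1) (proj₂ (+1-⊟1 r))))
          (0⋢-1 ∷ Allₚ.map⁺ fs) (λ _ → Above-≃ M ν (≃-sym (+1-⊟1 r)) r⋢)
          ((λ t → All.lookup fs (sub (here refl)) (⊑-trans t (⊑-trans (proj₁ (⊹-identityʳ _))
            (proj₁ (≡⇒≃ (cong (Values.value₋₁ M ν) (renameRPL-id A))))))) ∷ []) }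

theorem5 : (Sg : Signature) → let open Calculi Sg in
    (A : RPL) → Prenex A →
    (Provable¹ A ⇔ Provable² A) × (Provable² A ⇔ Provable³ A)
theorem5 Sg A pr =
  mk⇔ 1⇒2 (3⇒1 pr ∘ 2⇒3) , mk⇔ 2⇒3 (1⇒2 ∘ 3⇒1 pr)
  where
  open Translation Sg
  open Elimination Sg
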